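{- Let $T_n(x)=\sum_{k=0}^{n-1}|c_n(k)|x^k$. Then: (i) $T_n(-1)=\varphi(n)$ for every odd $n\ge 1$; (ii) $T_n(-1)=0$ for every $n=4k+2$, $k\ge 0$; (iii) $T_n(-1)=\varphi(n)2^{\omega(n)}$ for every $n=4k$, $k\ge 1$; (iv) $T_n(\eta)=n\prod_{p\mid n}\big(1-\frac{2}{p}\big)$ for every primitive $n$th root of unity $\eta$; moreover, the cyclotomic polynomial $\Phi_n(x)$ divides $T_n(x)$ for every even $n\ge 2$.
   Context: For integers $n\ge 1$ and $k$, the Ramanujan sum $c_n(k)$ is the sum of the $k$th powers of the primitive $n$th roots of unity, i.e. $c_n(k)=\sum_{1\le j\le n,\ \gcd(j,n)=1} e^{2\pi \sqrt{ -1}\, jk/n}$. $\varphi$ is Euler's function, $\omega(n)$ the number of distinct prime factors of $n$, and $\Phi_n(x)$ the $n$th cyclotomic polynomial. Products over $p$ are over primes. -}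

module Defs where

open import Level using (Level; _⊔_)
open import Algebra.Bundles using (CommutativeRing)
open import Data.Nat as ℕ using (ℕ; zero; suc; _≤_; _<_)
open import Data.Nat.Coprimality using (coprime?)
open import Data.Nat.Primality using (prime?)
open import Data.Nat.Divisibility using (_∣?_)
open import Data.Integer as ℤ using (ℤ; +_; -[1+_])
open import Data.Rational as ℚ using (ℚ)
open import Data.List using (List; []; _∷_; map; filter; upTo; length; foldr)
open import Data.Product using (_×_; Σ)
open import Data.Sum using (_⊎_)
open import Relation.Nullary using (¬_)
open import Relation.Binary.PropositionalEquality using (_≡_)

oneTo : ℕ → List ℕ
oneTo n = map suc (upTo n)

unitsMod : ℕ → List ℕ
unitsMod n = filter (λ j → coprime? j n) (oneTo n)

φ : ℕ → ℕ
φ n = length (unitsMod n)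

-- the distinct primes p dividing n (n ≥ 1), listed as j with p = suc j
primeDivisorsPred : ℕ → List ℕ
primeDivisorsPred n = filter (λ j → suc j ∣? n) (filter (λ j → prime? (suc j)) (upTo n))

ω : ℕ → ℕ
ω n = length (primeDivisorsPred n)

nProd12p : ℕ → ℚ
nProd12p n = foldr (λ j q → (ℚ.1ℚ ℚ.- (+ 2 ℚ./ suc j)) ℚ.* q)
                   (+ n ℚ./ 1) (primeDivisorsPred n)

sumℤ : List ℤ → ℤ
sumℤ = foldr ℤ._+_ (+ 0)

T-at-minus1 : ℕ → (ℕ → ℤ) → ℤ
T-at-minus1 n a = sumℤ (map (λ k → (+ ℤ.∣ a k ∣) ℤ.* ((ℤ.- (+ 1)) ℤ.^ k)) (upTo n))

-- Notions inside a commutative ring R (playing the role of ℂ)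

module _ {c ℓ : Level} (R : CommutativeRing c ℓ) where
  open CommutativeRing R

  pow : Carrier → ℕ → Carrier
  pow x zero    = 1#
  pow x (suc k) = x * pow x k

  ιℕ : ℕ → Carrier
  ιℕ zero    = 0#
  ιℕ (suc n) = 1# + ιℕ n

  ι : ℤ → Carrier
  ι (+ n)      = ιℕ n
  ι -[1+ n ]   = - ιℕ (suc n)

  sumR : List Carrier → Carrier
  sumR = foldr _+_ 0#

  IsIntegralDomain : Set (c ⊔ ℓ)
  IsIntegralDomain = (¬ (1# ≈ 0#)) × (∀ x y → x * y ≈ 0# → (x ≈ 0#) ⊎ (y ≈ 0#))

  CharZero : Set ℓ
  CharZero = ∀ m m′ → ι m ≈ ι m′ → m ≡ m′

  IsPrimitiveRoot : ℕ → Carrier → Set ℓ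
  IsPrimitiveRoot n η = (pow η n ≈ 1#) × (∀ d → 1 ≤ d → d < n → ¬ (pow η d ≈ 1#))

  -- Ramanujan sum c_n(k) = ∑_{1≤j≤n, gcd(j,n)=1} ζ^{jk}, ζ a fixed primitive
  -- n-th root of unity (in a domain the primitive n-th roots are exactly ζ^j)
  ramanujanSum : ℕ → Carrier → ℕ → Carrier
  ramanujanSum n ζ k = sumR (map (λ j → pow ζ (j ℕ.* k)) (unitsMod n))

  IsRamanujanTable : ℕ → Carrier → (ℕ → ℤ) → Set ℓ
  IsRamanujanTable n ζ a = ∀ k → k < n → ι (a k) ≈ ramanujanSum n ζ k

  -- polynomials over R: coefficient lists, lowest degree first
  Poly : Set c
  Poly = List Carrier

  coeff : Poly → ℕ → Carrier
  coeff []       _       = 0#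
  coeff (x ∷ _)  zero    = x
  coeff (_ ∷ p)  (suc i) = coeff p i

  _≈ₚ_ : Poly → Poly → Set ℓ
  p ≈ₚ q = ∀ i → coeff p i ≈ coeff q i

  _+ₚ_ : Poly → Poly → Poly
  []      +ₚ q       = q
  p       +ₚ []      = p
  (x ∷ p) +ₚ (y ∷ q) = (x + y) ∷ (p +ₚ q)

  scaleₚ : Carrier → Poly → Poly
  scaleₚ a = map (a *_)

  _*ₚ_ : Poly → Poly → Poly
  []      *ₚ q = []
  (x ∷ p) *ₚ q = scaleₚ x q +ₚ (0# ∷ (p *ₚ q))

  evalₚ : Poly → Carrier → Carrier
  evalₚ []      x = 0#
  evalₚ (a ∷ p) x = a + x * evalₚ p x

  cyclotomic : ℕ → Carrier → Poly
  cyclotomic n ζ = foldr (λ j p → ((- pow ζ j) ∷ 1# ∷ []) *ₚ p) (1# ∷ []) (unitsMod n)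

  Tpoly : ℕ → (ℕ → ℤ) → Poly
  Tpoly n a = map (λ k → ι (+ ℤ.∣ a k ∣)) (upTo n)

  _∣ₚ_ : Poly → Poly → Set (c ⊔ ℓ)
  f ∣ₚ g = Σ Poly (λ q → g ≈ₚ (f *ₚ q))

{-# OPTIONS --safe #-}

-- Let P be the set of primes dividing n, Q their product and n = N Q. For weights w_p and
-- a root of unity ζ of order Q, splitting off one prime at a time gives
--   Σ_{i<Q} ∏_{p∈P} (1 + w_p [p∣i]) ζ^{ik}  =  ∏_{p∈P} (w_p + p [p∣k]).
-- With w_p = −1 this shows that c_n(k) = 0 unless N ∣ k, and c_n(iN) = N ∏ (p [p∣i] − 1), so that
-- |c_n(iN)| = N ∏ (1 + (p−2) [p∣i]). This is again a product of the same shape, now with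
-- w_p = p − 2, hence T_n(η^k) = N ∏ (p − 2 + p [p∣k]) for every primitive n-th root of unity η.
-- Taking k = 1 gives (iv); for even n the factor at p = 2 vanishes whenever k is odd, which
-- gives Φ_n ∣ T_n; and −1 = η^{n/2} gives (ii) and (iii). For odd n the same splitting at
-- the point −1 in place of ζ^k yields ∏ (1 + w_p), which is (i).

module Submission where

open import Defs
open import Algebra.Bundles using (CommutativeRing)
import Algebra.Properties.Ring as RingProperties
import Algebra.Solver.Ring.NaturalCoefficients.Default as NaturalSolver
open import Data.Bool using (true; false; if_then_else_)
open import Data.Integer as ℤ using (ℤ; +_; -[1+_])
import Data.Integer.Properties as ℤₚ
open import Data.List using (List; []; _∷_; map; filter; applyUpTo; upTo; length; foldr)
open import Data.List.Membership.Propositional using (_∈_)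
open import Data.List.Membership.Propositional.Properties using (∈-filter⁺; ∈-upTo⁺)
open import Data.List.Relation.Unary.All as All using (All; []; _∷_)
import Data.List.Relation.Unary.All.Properties as Allₚ
open import Data.List.Relation.Unary.AllPairs using (AllPairs; []; _∷_)
import Data.List.Relation.Unary.AllPairs.Properties as AllPairsₚ
open import Data.List.Relation.Unary.Any using (here; there)
open import Data.List.Relation.Unary.Unique.Propositional using (Unique)
import Data.List.Relation.Unary.Unique.Propositional.Properties as Uniqueₚ
open import Data.Nat as ℕ using (ℕ; zero; suc; s≤s; z≤n)
open import Data.Nat.Coprimality using (Coprime; coprime?; gcd≡1⇒coprime)
open import Data.Nat.DivMod using (_%_; _/_; m≡m%n+[m/n]*n; m%n<n)
open import Data.Nat.Divisibility hiding (quotient)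
open import Data.Nat.GCD using (gcd; gcd[m,n]∣m; gcd[m,n]∣n; gcd[m,n]≢0)
open import Data.Nat.Primality
open import Data.Nat.Primality.Factorisation using (factorise)
import Data.Nat.Properties as ℕₚ
open import Data.Nat.Solver using (module +-*-Solver)
open import Data.Product using (Σ; ∃-syntax; _×_; _,_; proj₁; proj₂)
open import Data.Rational as ℚ using (ℚ)
import Data.Rational.Properties as ℚₚ
import Data.Rational.Unnormalised as ℚᵘ
import Data.Rational.Unnormalised.Properties as ℚᵘₚ
open import Data.Sum using (_⊎_; inj₁; inj₂)
open import Function using (_∘_; id)
open import Function.Bundles using (mk⇔)
open import Relation.Binary.PropositionalEquality as ≡ using (_≡_; _≢_)
open import Relation.Nullary using (¬_; Dec; yes; no; does; contradiction)
open import Relation.Nullary.Decidable using (dec-true; dec-false; does-⇔)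
open import Relation.Unary using (Pred; Decidable)

-- Elementary number theory

-- Branching on the boolean `does` keeps proofs of divisibility out of the term, so equivalent
-- conditions give propositionally equal values.
if-∣ : ∀ {a} {A : Set a} → ℕ → ℕ → A → A → A
if-∣ d k x y = if does (d ∣? k) then x else y

module _ {a} {A : Set a} {x y : A} where

  if-∣-yes : ∀ {d k} → d ∣ k → if-∣ d k x y ≡ x
  if-∣-yes {d} {k} d∣k = ≡.cong (λ b → if b then x else y) (dec-true (d ∣? k) d∣k)

  if-∣-no : ∀ {d k} → d ∤ k → if-∣ d k x y ≡ y
  if-∣-no {d} {k} d∤k = ≡.cong (λ b → if b then x else y) (dec-false (d ∣? k) d∤k)

  if-∣-⇔ : ∀ {d k l} → (d ∣ k → d ∣ l) → (d ∣ l → d ∣ k) → if-∣ d k x y ≡ if-∣ d l x y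
  if-∣-⇔ {d} {k} {l} to from =
    ≡.cong (λ b → if b then x else y) (does-⇔ (mk⇔ to from) (d ∣? k) (d ∣? l))

-- As in primeDivisorsPred, an entry j of a list of primes stands for the prime p = suc j.
∏suc : List ℕ → ℕ
∏suc = foldr (λ j → suc j ℕ.*_) 1

-- Coprimality in the form of Euclid's lemma: dilating an index by `suc i` leaves its divisibility
-- by `suc j` unchanged.
Independent : ℕ → ℕ → Set
Independent i j = ∀ k → suc j ∣ k ℕ.* suc i → suc j ∣ k

∣∏suc : ∀ P → All (λ j → suc j ∣ ∏suc P) P
∣∏suc []      = []
∣∏suc (j ∷ P) = m∣m*n (∏suc P) ∷ All.map (λ d → ∣n⇒∣m*n (suc j) d) (∣∏suc P)

∏suc-nonZero : ∀ P → ℕ.NonZero (∏suc P)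
∏suc-nonZero []      = _
∏suc-nonZero (j ∷ P) = ℕₚ.m*n≢0 (suc j) (∏suc P) {{_}} {{∏suc-nonZero P}}

-- Weighted character sums

module Sums {c ℓ} (R : CommutativeRing c ℓ) where
  open CommutativeRing R public
  open RingProperties ring public
  open import Relation.Binary.Reasoning.Setoid setoid public
  open NaturalSolver commutativeSemiring public using (solve; _:=_; _:+_; _:*_; con)

  infixr 8 _^_
  _^_ : Carrier → ℕ → Carrier
  _^_ = pow R

  ^-cong : ∀ {x y} k → x ≈ y → x ^ k ≈ y ^ k
  ^-cong zero    x≈y = refl
  ^-cong (suc k) x≈y = *-cong x≈y (^-cong k x≈y)

  ^-homo-+ : ∀ x m n → x ^ (m ℕ.+ n) ≈ x ^ m * x ^ n
  ^-homo-+ x zero    n = sym (*-identityˡ _)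
  ^-homo-+ x (suc m) n = trans (*-congˡ (^-homo-+ x m n)) (sym (*-assoc _ _ _))

  ^-assoc : ∀ x m n → x ^ (m ℕ.* n) ≈ (x ^ n) ^ m
  ^-assoc x zero    n = refl
  ^-assoc x (suc m) n = trans (^-homo-+ x n (m ℕ.* n)) (*-congˡ (^-assoc x m n))

  ^-assocʳ : ∀ x m n → x ^ (m ℕ.* n) ≈ (x ^ m) ^ n
  ^-assocʳ x m n = trans (reflexive (≡.cong (x ^_) (ℕₚ.*-comm m n))) (^-assoc x n m)

  ^-comm : ∀ x m n → (x ^ m) ^ n ≈ (x ^ n) ^ m
  ^-comm x m n = trans (sym (^-assocʳ x m n)) (^-assoc x m n)

  1^k≈1 : ∀ {x} k → x ≈ 1# → x ^ k ≈ 1#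
  1^k≈1 zero    x≈1 = refl
  1^k≈1 (suc k) x≈1 = trans (*-cong x≈1 (1^k≈1 k x≈1)) (*-identityˡ 1#)

  ιℕ-homo-+ : ∀ m n → ιℕ R (m ℕ.+ n) ≈ ιℕ R m + ιℕ R n
  ιℕ-homo-+ zero    n = sym (+-identityˡ _)
  ιℕ-homo-+ (suc m) n = trans (+-congˡ (ιℕ-homo-+ m n)) (sym (+-assoc _ _ _))

  ιℕ-homo-* : ∀ m n → ιℕ R (m ℕ.* n) ≈ ιℕ R m * ιℕ R n
  ιℕ-homo-* zero    n = sym (zeroˡ _)
  ιℕ-homo-* (suc m) n = begin
    ιℕ R (n ℕ.+ m ℕ.* n)             ≈⟨ ιℕ-homo-+ n (m ℕ.* n) ⟩
    ιℕ R n + ιℕ R (m ℕ.* n)          ≈⟨ +-cong (sym (*-identityˡ _)) (ιℕ-homo-* m n) ⟩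
    1# * ιℕ R n + ιℕ R m * ιℕ R n    ≈⟨ distribʳ _ _ _ ⟨
    (1# + ιℕ R m) * ιℕ R n           ∎

  ∏ : (ℕ → Carrier) → List ℕ → Carrier
  ∏ f = foldr (λ j x → f j * x) 1#

  ∏-cong : ∀ {f g P} → All (λ j → f j ≈ g j) P → ∏ f P ≈ ∏ g P
  ∏-cong []         = refl
  ∏-cong (eq ∷ eqs) = *-cong eq (∏-cong eqs)

  Σ< : ℕ → (ℕ → Carrier) → Carrier
  Σ< zero    f = 0#
  Σ< (suc n) f = f 0 + Σ< n (f ∘ suc)

  Σ<-cong : ∀ n {f g} → (∀ k → k ℕ.< n → f k ≈ g k) → Σ< n f ≈ Σ< n g
  Σ<-cong zero    eq = refl
  Σ<-cong (suc n) eq = +-cong (eq 0 (s≤s z≤n)) (Σ<-cong n (λ k k<n → eq (suc k) (s≤s k<n)))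

  Σ<-zero : ∀ n {f} → (∀ k → k ℕ.< n → f k ≈ 0#) → Σ< n f ≈ 0#
  Σ<-zero zero    eq = refl
  Σ<-zero (suc n) eq =
    trans (+-cong (eq 0 (s≤s z≤n)) (Σ<-zero n (λ k k<n → eq (suc k) (s≤s k<n)))) (+-identityˡ 0#)

  Σ<-distrib-+ : ∀ n f g → Σ< n (λ k → f k + g k) ≈ Σ< n f + Σ< n g
  Σ<-distrib-+ zero    f g = sym (+-identityˡ 0#)
  Σ<-distrib-+ (suc n) f g = trans (+-congˡ (Σ<-distrib-+ n (f ∘ suc) (g ∘ suc)))
    (solve 4 (λ a b s t → (a :+ b) :+ (s :+ t) := (a :+ s) :+ (b :+ t)) refl _ _ _ _)

  *-distribˡ-Σ< : ∀ n x f → x * Σ< n f ≈ Σ< n (λ k → x * f k)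
  *-distribˡ-Σ< zero    x f = zeroʳ x
  *-distribˡ-Σ< (suc n) x f = trans (distribˡ _ _ _) (+-congˡ (*-distribˡ-Σ< n x (f ∘ suc)))

  Σ<-split : ∀ m n f → Σ< (m ℕ.+ n) f ≈ Σ< m f + Σ< n (λ k → f (m ℕ.+ k))
  Σ<-split zero    n f = sym (+-identityˡ _)
  Σ<-split (suc m) n f = trans (+-congˡ (Σ<-split m n (f ∘ suc))) (sym (+-assoc _ _ _))

  Σ<-last : ∀ n f → Σ< (suc n) f ≈ Σ< n f + f n
  Σ<-last zero    f = +-comm _ _
  Σ<-last (suc n) f = trans (+-congˡ (Σ<-last n (f ∘ suc))) (sym (+-assoc _ _ _))

  -- Adding `f 0` completes both sides to the sum over 0, ..., n. This trades the residues 1, ..., n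
  -- for 0, ..., n - 1.
  Σ<-rotate : ∀ n f → f n ≈ f 0 → Σ< n (f ∘ suc) ≈ Σ< n f
  Σ<-rotate n f fn≈f0 = +-cancelˡ (f 0) _ _ (begin
    Σ< (suc n) f     ≈⟨ Σ<-last n f ⟩
    Σ< n f + f n     ≈⟨ +-congˡ fn≈f0 ⟩
    Σ< n f + f 0     ≈⟨ +-comm _ _ ⟩
    f 0 + Σ< n f     ∎)

  -- Cut the range into blocks of length `suc j`; only the first index of each block is a multiple.
  Σ<-multiples : ∀ m j h → Σ< (m ℕ.* suc j) (λ k → if-∣ (suc j) k (h k) 0#) ≈
                           Σ< m (λ i → h (i ℕ.* suc j))
  Σ<-multiples zero    j h = refl
  Σ<-multiples (suc m) j h = begin
    Σ< (suc j ℕ.+ m ℕ.* suc j) f                          ≈⟨ Σ<-split (suc j) (m ℕ.* suc j) f ⟩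
    Σ< (suc j) f + Σ< (m ℕ.* suc j) (λ k → f (suc j ℕ.+ k)) ≈⟨ +-cong head tail ⟩
    h 0 + Σ< m (λ i → h (suc i ℕ.* suc j))                 ∎
    where
    f : ℕ → Carrier
    f k = if-∣ (suc j) k (h k) 0#
    head : Σ< (suc j) f ≈ h 0
    head = trans (+-cong (reflexive (if-∣-yes {y = 0#} {d = suc j} (suc j ∣0)))
                         (Σ<-zero j (λ k k<j → reflexive (if-∣-no (>⇒∤ (s≤s k<j))))))
                 (+-identityʳ (h 0))
    tail : Σ< (m ℕ.* suc j) (λ k → f (suc j ℕ.+ k)) ≈ Σ< m (λ i → h (suc i ℕ.* suc j))
    tail = trans (Σ<-cong (m ℕ.* suc j) (λ k _ → reflexive
                   (if-∣-⇔ {d = suc j} {k = suc j ℕ.+ k} (λ d → ∣m+n∣m⇒∣n d ∣-refl) (∣m∣n⇒∣m+n ∣-refl))))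
                 (Σ<-multiples m j (λ k → h (suc j ℕ.+ k)))

  geometric : ℕ → Carrier → Carrier
  geometric n x = Σ< n (x ^_)

  geometric-suc : ∀ n x → geometric (suc n) x ≈ 1# + x * geometric n x
  geometric-suc n x = +-congˡ (sym (*-distribˡ-Σ< n x (x ^_)))

  geometric-1 : ∀ n {x} → x ≈ 1# → geometric n x ≈ ιℕ R n
  geometric-1 zero    x≈1 = refl
  geometric-1 (suc n) {x} x≈1 = trans (geometric-suc n x)
    (+-congˡ (trans (*-cong x≈1 (geometric-1 n x≈1)) (*-identityˡ _)))

  -- Both sides are the geometric sum of length n + 1; no subtraction occurs.
  geometric-telescope : ∀ n x → 1# + x * geometric n x ≈ geometric n x + x ^ n
  geometric-telescope n x = trans (sym (geometric-suc n x)) (Σ<-last n (x ^_))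

  -- Passing to the next period repeats `f` and multiplies the powers of `θ` by `θ ^ d`, so the
  -- periods form a geometric sum.
  Σ<-periodic : ∀ m d θ (f : ℕ → Carrier) → (∀ k → f (d ℕ.+ k) ≡ f k) →
    Σ< (m ℕ.* d) (λ k → f k * θ ^ k) ≈ geometric m (θ ^ d) * Σ< d (λ k → f k * θ ^ k)
  Σ<-periodic zero    d θ f per = sym (zeroˡ _)
  Σ<-periodic (suc m) d θ f per = begin
    Σ< (d ℕ.+ m ℕ.* d) g                       ≈⟨ Σ<-split d (m ℕ.* d) g ⟩
    S + Σ< (m ℕ.* d) (λ k → g (d ℕ.+ k))       ≈⟨ +-congˡ (Σ<-cong (m ℕ.* d) (λ k _ → shift k)) ⟩
    S + Σ< (m ℕ.* d) (λ k → θ ^ d * g k)       ≈⟨ +-congˡ (*-distribˡ-Σ< (m ℕ.* d) (θ ^ d) g) ⟨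
    S + θ ^ d * Σ< (m ℕ.* d) g                 ≈⟨ +-congˡ (*-congˡ (Σ<-periodic m d θ f per)) ⟩
    S + θ ^ d * (geometric m (θ ^ d) * S)
      ≈⟨ solve 3 (λ s x g → s :+ x :* (g :* s) := (con 1 :+ x :* g) :* s) refl _ _ _ ⟩
    (1# + θ ^ d * geometric m (θ ^ d)) * S     ≈⟨ *-congʳ (geometric-suc m (θ ^ d)) ⟨
    geometric (suc m) (θ ^ d) * S              ∎
    where
    g : ℕ → Carrier
    g k = f k * θ ^ k
    S = Σ< d g
    shift : ∀ k → g (d ℕ.+ k) ≈ θ ^ d * g k
    shift k = trans (*-cong (reflexive (per k)) (^-homo-+ θ d k))
      (solve 3 (λ a b c → a :* (b :* c) := b :* (a :* c)) refl _ _ _)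

  localFactor : (ℕ → Carrier) → ℕ → ℕ → Carrier
  localFactor w k j = if-∣ (suc j) k (1# + w j) 1#

  -- The Fourier transform of `localFactor` at one prime p: for ζ of order p, the sum of (1 + w
  -- [p∣i]) ζ^{ik} over i < p is w, plus p when p divides k.
  dualFactor : (ℕ → Carrier) → ℕ → ℕ → Carrier
  dualFactor w k j = if-∣ (suc j) k (ιℕ R (suc j) + w j) (w j)

  -- The length `m` is left free: it is n itself for the Ramanujan sum and `∏suc P` after
  -- periodicity has been used.
  twistedSum : (ℕ → Carrier) → List ℕ → ℕ → Carrier → Carrier
  twistedSum w P m θ = Σ< m (λ k → ∏ (localFactor w k) P * θ ^ k)

  twistedSum-cong : ∀ w P m {θ θ′} → θ ≈ θ′ → twistedSum w P m θ ≈ twistedSum w P m θ′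
  twistedSum-cong w P m eq = Σ<-cong m (λ k _ → *-congˡ (^-cong k eq))

  ∏-≡ : ∀ {f g : ℕ → Carrier} {P} → All (λ j → f j ≡ g j) P → ∏ f P ≡ ∏ g P
  ∏-≡ []         = ≡.refl
  ∏-≡ (eq ∷ eqs) = ≡.cong₂ _*_ eq (∏-≡ eqs)

  local-periodic : ∀ w {d P} → All (λ j → suc j ∣ d) P → ∀ k →
    ∏ (localFactor w (d ℕ.+ k)) P ≡ ∏ (localFactor w k) P
  local-periodic w P∣d k = ∏-≡ (All.map
    (λ p∣d → if-∣-⇔ (λ p∣d+k → ∣m+n∣m⇒∣n p∣d+k p∣d) (∣m∣n⇒∣m+n p∣d)) P∣d)

  local-dilate : ∀ w {i P} → All (Independent i) P → ∀ k →
    ∏ (localFactor w (k ℕ.* suc i)) P ≡ ∏ (localFactor w k) P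
  local-dilate w {i} ind k =
    ∏-≡ (All.map (λ f → if-∣-⇔ (f k) (∣m⇒∣m*n (suc i))) ind)

  dual-dilate : ∀ w {i P} → All (Independent i) P → ∀ k →
    ∏ (dualFactor w (k ℕ.* suc i)) P ≡ ∏ (dualFactor w k) P
  dual-dilate w {i} ind k =
    ∏-≡ (All.map (λ f → if-∣-⇔ (f k) (∣m⇒∣m*n (suc i))) ind)

  -- Expand the factor 1 + w [p∣k] at p = `suc j`. The 1 leaves p periods of the remaining product;
  -- the w leaves only k = ip, where independence lets i replace k in the other factors. As `θ` is
  -- arbitrary, this serves roots of unity and -1 alike.
  twistedSum-∷ : ∀ w j P m θ → All (λ i → suc i ∣ m) P → All (Independent j) P →
    twistedSum w (j ∷ P) (suc j ℕ.* m) θ ≈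
      geometric (suc j) (θ ^ m) * twistedSum w P m θ + w j * twistedSum w P m (θ ^ suc j)
  twistedSum-∷ w j P m θ P∣m ind = begin
    twistedSum w (j ∷ P) M θ                        ≈⟨ Σ<-cong M (λ k _ → expand k) ⟩
    Σ< M (λ k → g k + if-∣ (suc j) k (w j * g k) 0#) ≈⟨ Σ<-distrib-+ M g _ ⟩
    Σ< M g + Σ< M (λ k → if-∣ (suc j) k (w j * g k) 0#)
      ≈⟨ +-cong (Σ<-periodic (suc j) m θ (λ k → ∏ (localFactor w k) P) (local-periodic w P∣m)) multiples ⟩
    geometric (suc j) (θ ^ m) * twistedSum w P m θ + w j * twistedSum w P m (θ ^ suc j) ∎
    where
    M = suc j ℕ.* m
    g : ℕ → Carrier
    g k = ∏ (localFactor w k) P * θ ^ k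
    expand : ∀ k → ∏ (localFactor w k) (j ∷ P) * θ ^ k ≈ g k + if-∣ (suc j) k (w j * g k) 0#
    expand k with does (suc j ∣? k)
    ... | true  = solve 3 (λ a b c → ((con 1 :+ a) :* b) :* c := b :* c :+ a :* (b :* c)) refl _ _ _
    ... | false = solve 2 (λ b c → (con 1 :* b) :* c := b :* c :+ con 0) refl _ _
    multiples : Σ< M (λ k → if-∣ (suc j) k (w j * g k) 0#) ≈ w j * twistedSum w P m (θ ^ suc j)
    multiples = begin
      Σ< M (λ k → if-∣ (suc j) k (w j * g k) 0#)
        ≡⟨ ≡.cong (λ M → Σ< M (λ k → if-∣ (suc j) k (w j * g k) 0#)) (ℕₚ.*-comm (suc j) m) ⟩
      Σ< (m ℕ.* suc j) (λ k → if-∣ (suc j) k (w j * g k) 0#) ≈⟨ Σ<-multiples m j (λ k → w j * g k) ⟩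
      Σ< m (λ i → w j * g (i ℕ.* suc j))                      ≈⟨ *-distribˡ-Σ< m (w j) _ ⟨
      w j * Σ< m (λ i → g (i ℕ.* suc j))
        ≈⟨ *-congˡ (Σ<-cong m (λ i _ → *-cong (reflexive (local-dilate w ind i)) (^-assoc θ i (suc j)))) ⟩
      w j * twistedSum w P m (θ ^ suc j) ∎

-- Roots of unity in a domain

module Roots {c ℓ} (R : CommutativeRing c ℓ)
             (domain : IsIntegralDomain R) (charZero : CharZero R) where
  open Sums R public

  -1≉1 : ¬ (- 1# ≈ 1#)
  -1≉1 eq = contradiction (charZero -[1+ 0 ] (+ 1) (begin
    - (1# + 0#)  ≈⟨ -‿cong (+-identityʳ 1#) ⟩
    - 1#         ≈⟨ eq ⟩
    1#           ≈⟨ +-identityʳ 1# ⟨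
    1# + 0#      ∎)) λ ()

  -- The equation is (x - 1) y = 0. The cancellation arguments below are brought into this form by a
  -- suitable choice of y.
  *-fixes : ∀ {x y} → x * y ≈ y → x ≈ 1# ⊎ y ≈ 0#
  *-fixes {x} {y} xy≈y with proj₂ domain (x - 1#) y (begin
    (x - 1#) * y       ≈⟨ distribʳ y x (- 1#) ⟩
    x * y + - 1# * y   ≈⟨ +-cong xy≈y (-1*x≈-x y) ⟩
    y - y              ≈⟨ -‿inverseʳ y ⟩
    0#                 ∎)
  ... | inj₁ x-1≈0 = inj₁ (x∙y⁻¹≈ε⇒x≈y x 1# x-1≈0)
  ... | inj₂ y≈0   = inj₂ y≈0

  -- When xⁿ = 1 the telescoping identity says that x fixes its geometric sum.
  geometric-root : ∀ n {x} → x ^ n ≈ 1# → ¬ (x ≈ 1#) → geometric n x ≈ 0#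
  geometric-root n {x} xⁿ≈1 x≉1 with *-fixes (+-cancelˡ 1# _ _ (begin
    1# + x * geometric n x   ≈⟨ geometric-telescope n x ⟩
    geometric n x + x ^ n    ≈⟨ +-congˡ xⁿ≈1 ⟩
    geometric n x + 1#       ≈⟨ +-comm _ _ ⟩
    1# + geometric n x       ∎))
  ... | inj₁ x≈1 = contradiction x≈1 x≉1
  ... | inj₂ g≈0 = g≈0

  -1*-1≈1 : - 1# * - 1# ≈ 1#
  -1*-1≈1 = trans (-1*x≈-x (- 1#)) (-‿involutive 1#)

  geometric-[-1] : ∀ n → (- 1#) ^ n ≈ - 1# → geometric n (- 1#) ≈ 1#
  -- Telescoping gives 1 - g = g - 1, so -1 fixes g - 1.
  geometric-[-1] n eq with *-fixes { - 1# } {geometric n (- 1#) - 1#} (begin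
    - 1# * (g - 1#)           ≈⟨ distribˡ _ _ _ ⟩
    - 1# * g + - 1# * - 1#    ≈⟨ +-congˡ -1*-1≈1 ⟩
    - 1# * g + 1#             ≈⟨ +-comm _ _ ⟩
    1# + - 1# * g             ≈⟨ geometric-telescope n (- 1#) ⟩
    g + (- 1#) ^ n            ≈⟨ +-congˡ eq ⟩
    g - 1#                    ∎)
    where g = geometric n (- 1#)
  ... | inj₁ -1≈1 = contradiction -1≈1 -1≉1
  ... | inj₂ eq0  = x∙y⁻¹≈ε⇒x≈y _ _ eq0

  square-root-of-1 : ∀ {x} → x * x ≈ 1# → ¬ (x ≈ 1#) → x ≈ - 1#
  square-root-of-1 {x} xx≈1 x≉1 with *-fixes {x} {1# + x} (begin
    x * (1# + x)      ≈⟨ distribˡ _ _ _ ⟩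
    x * 1# + x * x    ≈⟨ +-cong (*-identityʳ x) xx≈1 ⟩
    x + 1#            ≈⟨ +-comm _ _ ⟩
    1# + x            ∎)
  ... | inj₁ x≈1   = contradiction x≈1 x≉1
  ... | inj₂ 1+x≈0 = +-inverseʳ-unique 1# x 1+x≈0

  [-1]^k : ∀ k → (- 1#) ^ k ≈ 1# ⊎ (- 1#) ^ k ≈ - 1#
  [-1]^k zero    = inj₁ refl
  [-1]^k (suc k) with [-1]^k k
  ... | inj₁ eq = inj₂ (trans (*-congˡ eq) (*-identityʳ _))
  ... | inj₂ eq = inj₁ (trans (*-congˡ eq) -1*-1≈1)

  [-1]^odd : ∀ {n} k → n ≡ 2 ℕ.* k ℕ.+ 1 → (- 1#) ^ n ≈ - 1#
  [-1]^odd k ≡.refl = begin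
    (- 1#) ^ (2 ℕ.* k ℕ.+ 1)        ≈⟨ ^-homo-+ (- 1#) (2 ℕ.* k) 1 ⟩
    (- 1#) ^ (2 ℕ.* k) * (- 1#) ^ 1 ≈⟨ *-cong even (*-identityʳ (- 1#)) ⟩
    1# * - 1#                       ≈⟨ *-identityˡ (- 1#) ⟩
    - 1#                            ∎
    where
    even : (- 1#) ^ (2 ℕ.* k) ≈ 1#
    even = trans (^-assocʳ (- 1#) 2 k) (1^k≈1 k (trans (*-congˡ (*-identityʳ (- 1#))) -1*-1≈1))

  -- Oddness is expressed through the power of -1; it passes to divisors because (-1)^m = 1 would
  -- force (-1)^n = 1.
  [-1]^-factor : ∀ {m n} → (- 1#) ^ n ≈ - 1# → m ∣ n → (- 1#) ^ m ≈ - 1#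
  [-1]^-factor {m} eq (divides q ≡.refl) with [-1]^k m
  ... | inj₁ eq1 = contradiction (trans (sym eq) (trans (^-assoc (- 1#) q m) (1^k≈1 q eq1))) -1≉1
  ... | inj₂ eq2 = eq2

  -- Minimality is phrased by divisibility, so that it passes to powers by cancelling a factor.
  HasOrder : ℕ → Carrier → Set ℓ
  HasOrder n ζ = ζ ^ n ≈ 1# × (∀ e → ζ ^ e ≈ 1# → n ∣ e)

  primitive⇒order : ∀ {n ζ} → 1 ℕ.≤ n → IsPrimitiveRoot R n ζ → HasOrder n ζ
  primitive⇒order {suc n-1} {ζ} _ (ζⁿ≈1 , minimal) = ζⁿ≈1 , divides-exponent
    where
    n = suc n-1
    divides-exponent : ∀ e → ζ ^ e ≈ 1# → n ∣ e
    divides-exponent e ζᵉ≈1 with e % n in eq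
    ... | zero  = m%n≡0⇒n∣m e n eq
    ... | suc r = contradiction ζʳ≈1
                    (minimal (suc r) (s≤s z≤n) (≡.subst (ℕ._< n) eq (m%n<n e n)))
      where
      ζʳ≈1 : ζ ^ suc r ≈ 1#
      ζʳ≈1 = begin
        ζ ^ suc r                            ≡⟨ ≡.cong (ζ ^_) eq ⟨
        ζ ^ (e % n)                          ≈⟨ *-identityʳ _ ⟨
        ζ ^ (e % n) * 1#                     ≈⟨ *-congˡ (1^k≈1 (e / n) ζⁿ≈1) ⟨
        ζ ^ (e % n) * (ζ ^ n) ^ (e / n)      ≈⟨ *-congˡ (^-assoc ζ (e / n) n) ⟨
        ζ ^ (e % n) * ζ ^ (e / n ℕ.* n)      ≈⟨ ^-homo-+ ζ (e % n) (e / n ℕ.* n) ⟨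
        ζ ^ (e % n ℕ.+ e / n ℕ.* n)          ≡⟨ ≡.cong (ζ ^_) (m≡m%n+[m/n]*n e n) ⟨
        ζ ^ e                                ≈⟨ ζᵉ≈1 ⟩
        1#                                   ∎

  order-^ : ∀ {m ζ} d .{{_ : ℕ.NonZero d}} → HasOrder (d ℕ.* m) ζ → HasOrder m (ζ ^ d)
  order-^ {m} {ζ} d (ζ^dm≈1 , minimal) =
    trans (sym (^-assocʳ ζ d m)) ζ^dm≈1 ,
    λ e eq → *-cancelˡ-∣ d (minimal (d ℕ.* e) (trans (^-assocʳ ζ d e) eq))

  -- An equality makes ζ^{j-i} fix ζ^{i+1}. The first must not be 1, as 0 < j - i < n, and the
  -- second must not be 0, as its n-th power is 1. The exponents are successors to match the range
  -- 1, ..., n of `oneTo`.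
  powers-distinct : ∀ {n ζ i j} → HasOrder n ζ → i ℕ.< j → j ℕ.< n → ¬ (ζ ^ suc j ≈ ζ ^ suc i)
  powers-distinct {n} {ζ} {i} {j} (ζⁿ≈1 , minimal) i<j j<n eq with *-fixes {ζ ^ d} {ζ ^ suc i} (begin
    ζ ^ d * ζ ^ suc i    ≈⟨ ^-homo-+ ζ d (suc i) ⟨
    ζ ^ (d ℕ.+ suc i)    ≡⟨ ≡.cong (ζ ^_) (ℕₚ.m∸n+n≡m (ℕₚ.m≤n⇒m≤1+n i<j)) ⟩
    ζ ^ suc j            ≈⟨ eq ⟩
    ζ ^ suc i            ∎)
    where d = suc j ℕ.∸ suc i
  ... | inj₁ ζᵈ≈1 = ℕₚ.<⇒≱ (ℕₚ.≤-<-trans (ℕₚ.m∸n≤m j i) j<n)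
                      (∣⇒≤ {{ℕ.>-nonZero (ℕₚ.m<n⇒0<n∸m i<j)}} (minimal (j ℕ.∸ i) ζᵈ≈1))
  ... | inj₂ ζⁱ≈0 = proj₁ domain (begin
    1#                       ≈⟨ 1^k≈1 (suc i) ζⁿ≈1 ⟨
    (ζ ^ n) ^ suc i          ≈⟨ ^-comm ζ n (suc i) ⟩
    (ζ ^ suc i) ^ n          ≈⟨ 0^n≈0 (ℕₚ.≤-<-trans z≤n j<n) ζⁱ≈0 ⟩
    0#                       ∎)
    where
    0^n≈0 : ∀ {x n} → 0 ℕ.< n → x ≈ 0# → x ^ n ≈ 0#
    0^n≈0 (s≤s _) x≈0 = trans (*-congʳ x≈0) (zeroˡ _)

  twistedSum-[] : ∀ w θ → twistedSum w [] 1 θ ≈ 1#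
  twistedSum-[] w θ = trans (+-identityʳ _) (*-identityˡ 1#)

  -- Induction on `P`, with ξ = ζ^p of order `∏suc P` for the remaining primes. In the splitting,
  -- the second sum is taken at ξ^k. The geometric factor of the first is a sum of powers of the
  -- p-th root of unity ζ^{km}: it is p or 0 according as p divides k or not.
  twistedSum-root : ∀ w {P ζ} → AllPairs Independent P → HasOrder (∏suc P) ζ → ∀ k →
    twistedSum w P (∏suc P) (ζ ^ k) ≈ ∏ (dualFactor w k) P
  twistedSum-root w {[]}    {ζ} _            _   k = twistedSum-[] w (ζ ^ k)
  twistedSum-root w {j ∷ P} {ζ} (ind ∷ inds) ord k =
    trans (twistedSum-∷ w j P m (ζ ^ k) (∣∏suc P) ind) (main (suc j ∣? k))
    where
    m = ∏suc P
    ξ = ζ ^ suc j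
    D = ∏ (dualFactor w k) P
    ξ-order : HasOrder m ξ
    ξ-order = order-^ (suc j) ord
    second : twistedSum w P m ((ζ ^ k) ^ suc j) ≈ D
    second = trans (twistedSum-cong w P m (^-comm ζ k (suc j))) (twistedSum-root w inds ξ-order k)
    main : Dec (suc j ∣ k) →
      geometric (suc j) ((ζ ^ k) ^ m) * twistedSum w P m (ζ ^ k) +
        w j * twistedSum w P m ((ζ ^ k) ^ suc j) ≈ dualFactor w k j * D
    main (yes p∣k@(divides k′ ≡.refl)) = begin
      geometric (suc j) ((ζ ^ k) ^ m) * twistedSum w P m (ζ ^ k) +
        w j * twistedSum w P m ((ζ ^ k) ^ suc j)
        ≈⟨ +-cong (*-cong (geometric-1 (suc j) trivial) first) (*-congˡ second) ⟩
      ιℕ R (suc j) * D + w j * D    ≈⟨ distribʳ D _ _ ⟨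
      (ιℕ R (suc j) + w j) * D      ≈⟨ *-congʳ (reflexive (if-∣-yes p∣k)) ⟨
      dualFactor w k j * D          ∎
      where
      trivial : (ζ ^ k) ^ m ≈ 1#
      trivial = trans (^-cong m (^-assoc ζ k′ (suc j))) (trans (^-comm ξ k′ m) (1^k≈1 k′ (proj₁ ξ-order)))
      first : twistedSum w P m (ζ ^ k) ≈ D
      first = begin
        twistedSum w P m (ζ ^ k)     ≈⟨ twistedSum-cong w P m (^-assoc ζ k′ (suc j)) ⟩
        twistedSum w P m (ξ ^ k′)    ≈⟨ twistedSum-root w inds ξ-order k′ ⟩
        -- Here k = k′ p, and the remaining primes divide k exactly when they divide k′.
        ∏ (dualFactor w k′) P        ≡⟨ dual-dilate w ind k′ ⟨
        D                            ∎
    main (no p∤k) = begin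
      geometric (suc j) ((ζ ^ k) ^ m) * twistedSum w P m (ζ ^ k) +
        w j * twistedSum w P m ((ζ ^ k) ^ suc j)
        ≈⟨ +-cong (*-congʳ (geometric-root (suc j) root nontrivial)) (*-congˡ second) ⟩
      0# * twistedSum w P m (ζ ^ k) + w j * D   ≈⟨ +-congʳ (zeroˡ _) ⟩
      0# + w j * D                              ≈⟨ +-identityˡ _ ⟩
      w j * D                                   ≈⟨ *-congʳ (reflexive (if-∣-no p∤k)) ⟨
      dualFactor w k j * D                      ∎
      where
      root : ((ζ ^ k) ^ m) ^ suc j ≈ 1#
      root = begin
        ((ζ ^ k) ^ m) ^ suc j      ≈⟨ ^-assoc (ζ ^ k) (suc j) m ⟨
        (ζ ^ k) ^ (suc j ℕ.* m)    ≈⟨ ^-comm ζ k (suc j ℕ.* m) ⟩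
        (ζ ^ (suc j ℕ.* m)) ^ k    ≈⟨ 1^k≈1 k (proj₁ ord) ⟩
        1#                         ∎
      nontrivial : ¬ ((ζ ^ k) ^ m ≈ 1#)
      -- ζ^{km} = 1 would make the order pm divide km.
      nontrivial eq = p∤k (*-cancelʳ-∣ m {{∏suc-nonZero P}} (proj₂ ord (k ℕ.* m) (trans (^-assocʳ ζ k m) eq)))

  -- All factors of the length are odd, so each geometric sum at -1 is 1 and (-1)^p = -1: both sums
  -- of the splitting coincide.
  twistedSum-[-1] : ∀ w {P} → AllPairs Independent P → (- 1#) ^ ∏suc P ≈ - 1# →
    twistedSum w P (∏suc P) (- 1#) ≈ ∏ (λ j → 1# + w j) P
  twistedSum-[-1] w {[]}    _            _  = twistedSum-[] w (- 1#)
  twistedSum-[-1] w {j ∷ P} (ind ∷ inds) odd = begin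
    twistedSum w (j ∷ P) (suc j ℕ.* m) (- 1#)
      ≈⟨ twistedSum-∷ w j P m (- 1#) (∣∏suc P) ind ⟩
    geometric (suc j) ((- 1#) ^ m) * twistedSum w P m (- 1#) + w j * twistedSum w P m ((- 1#) ^ suc j)
      ≈⟨ +-cong (*-cong g≈1 (twistedSum-[-1] w inds odd-m))
                (*-congˡ (trans (twistedSum-cong w P m odd-p) (twistedSum-[-1] w inds odd-m))) ⟩
    1# * ∏ (λ i → 1# + w i) P + w j * ∏ (λ i → 1# + w i) P   ≈⟨ distribʳ _ _ _ ⟨
    (1# + w j) * ∏ (λ i → 1# + w i) P                        ∎
    where
    m = ∏suc P
    odd-p : (- 1#) ^ suc j ≈ - 1#
    odd-p = [-1]^-factor odd (m∣m*n {suc j} m)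
    odd-m : (- 1#) ^ m ≈ - 1#
    odd-m = [-1]^-factor odd (n∣m*n (suc j) {m})
    g≈1 : geometric (suc j) ((- 1#) ^ m) ≈ 1#
    g≈1 = trans (Σ<-cong (suc j) (λ i _ → ^-cong i odd-m)) (geometric-[-1] (suc j) odd-p)

-- Prime divisors

prime-divisor : ∀ m .{{_ : ℕ.NonZero m}} → m ≢ 1 → ∃[ p ] Prime p × p ∣ m
prime-divisor m m≢1 with factorise m
... | record { factors = []     ; isFactorisation = eq } = contradiction eq m≢1
... | record { factors = p ∷ ps ; isFactorisation = eq ; factorsPrime = pp ∷ _ } =
  p , pp , ≡.subst (p ∣_) (≡.sym eq) (m∣m*n _)

prime⇒1≤pred : ∀ {j} → Prime (suc j) → 1 ℕ.≤ j
prime⇒1≤pred {zero}  pp = contradiction pp ¬prime[1]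
prime⇒1≤pred {suc j} pp = s≤s z≤n

4k+2≡2[2k+1] : ∀ k → 4 ℕ.* k ℕ.+ 2 ≡ 2 ℕ.* (2 ℕ.* k ℕ.+ 1)
4k+2≡2[2k+1] = solve 1 (λ k → con 4 :* k :+ con 2 := con 2 :* (con 2 :* k :+ con 1)) ≡.refl
  where open +-*-Solver

2∤2k+1 : ∀ k → 2 ∤ 2 ℕ.* k ℕ.+ 1
2∤2k+1 k 2∣2k+1 = contradiction (∣1⇒≡1 (∣m+n∣m⇒∣n 2∣2k+1 (m∣m*n k))) λ ()

distinct-primes-independent : ∀ {i j} → Prime (suc i) → Prime (suc j) → i ≢ j → Independent i j
distinct-primes-independent {i} {j} pi pj i≢j k d with euclidsLemma k (suc i) pj d
... | inj₁ j∣k = j∣k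
... | inj₂ j∣i with prime⇒irreducible pi j∣i
...   | inj₁ sj≡1  = contradiction (≡.subst Prime sj≡1 pj) ¬prime[1]
...   | inj₂ sj≡si = contradiction (≡.sym (ℕₚ.suc-injective sj≡si)) i≢j

primes-independent : ∀ {P} → All (Prime ∘ suc) P → Unique P → AllPairs Independent P
primes-independent []       []       = []
primes-independent (p ∷ ps) (u ∷ us) =
  All.zipWith (λ (q , i≢j) → distinct-primes-independent p q i≢j) (ps , u) ∷ primes-independent ps us

-- Once n = q p is written out for the first prime p, independence makes the other primes divide q.
∏suc∣ : ∀ {P n} → AllPairs Independent P → All (λ j → suc j ∣ n) P → ∏suc P ∣ n
∏suc∣ []           []                      = 1∣ _
∏suc∣ {j ∷ P} (ind ∷ inds) (divides q ≡.refl ∷ P∣n) =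
  ≡.subst (suc j ℕ.* ∏suc P ∣_) (ℕₚ.*-comm (suc j) q)
    (*-monoʳ-∣ (suc j) (∏suc∣ inds (All.zipWith (λ (f , d) → f q d) (ind , P∣n))))

module PrimeDivisors (n : ℕ) where

  P : List ℕ
  P = primeDivisorsPred n

  P-prime : All (Prime ∘ suc) P
  P-prime = Allₚ.filter⁺ (λ j → suc j ∣? n) (Allₚ.all-filter (λ j → prime? (suc j)) (upTo n))

  P∣n : All (λ j → suc j ∣ n) P
  P∣n = Allₚ.all-filter (λ j → suc j ∣? n) (filter (λ j → prime? (suc j)) (upTo n))

  P-independent : AllPairs Independent P
  P-independent = primes-independent P-prime
    (Uniqueₚ.filter⁺ (λ j → suc j ∣? n) (Uniqueₚ.filter⁺ (λ j → prime? (suc j)) (Uniqueₚ.upTo⁺ n)))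

  P-complete : ∀ {j} .{{_ : ℕ.NonZero n}} → Prime (suc j) → suc j ∣ n → j ∈ P
  P-complete pp j∣n = ∈-filter⁺ (λ j → suc j ∣? n)
    -- The bound `suc j ≤ n` is by definition `j < n`, the range of `upTo n`.
    (∈-filter⁺ (λ j → prime? (suc j)) (∈-upTo⁺ (∣⇒≤ j∣n)) pp) j∣n

  coprime⇒P∤ : ∀ {k} → Coprime k n → All (λ j → suc j ∤ k) P
  coprime⇒P∤ cop = All.zipWith
    (λ (pp , j∣n) j∣k → ¬prime[1] (≡.subst Prime (cop (j∣k , j∣n)) pp)) (P-prime , P∣n)

  ¬coprime⇒P∣ : ∀ {k} .{{_ : ℕ.NonZero n}} → ¬ Coprime k n → ∃[ j ] j ∈ P × suc j ∣ k
  ¬coprime⇒P∣ {k} ¬cop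
    with prime-divisor (gcd k n) {{ℕ.≢-nonZero (gcd[m,n]≢0 k n (inj₂ (ℕ.≢-nonZero⁻¹ n)))}} (¬cop ∘ gcd≡1⇒coprime)
  ... | zero  , pp , _ = contradiction pp ¬prime[0]
  ... | suc j , pp , d =
    j , P-complete pp (∣-trans d (gcd[m,n]∣n k n)) , ∣-trans d (gcd[m,n]∣m k n)

-- Products over primes, and the rational product as an integer

∏ℕ : (ℕ → ℕ) → List ℕ → ℕ
∏ℕ f = foldr (λ j x → f j ℕ.* x) 1

∏ℕ-double : ∀ P → ∏ℕ (2 ℕ.*_) P ≡ ∏ℕ (λ j → j) P ℕ.* 2 ℕ.^ length P
∏ℕ-double []      = ≡.refl
∏ℕ-double (j ∷ P) = ≡.trans (≡.cong (2 ℕ.* j ℕ.*_) (∏ℕ-double P))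
  (solve 3 (λ a b c → (con 2 :* a) :* (b :* c) := (a :* b) :* (con 2 :* c)) ≡.refl j _ _)
  where open +-*-Solver

-- (1 - 2/p) p = p - 2 = j - 1, and the truncated subtraction is exact since j ≥ 1. The computation
-- runs in unnormalised rationals, where equality is cross-multiplication.
[1-2/p]*[p*y] : ∀ j y → 1 ℕ.≤ j →
  (ℚ.1ℚ ℚ.- (+ 2 ℚ./ suc j)) ℚ.* (+ (suc j ℕ.* y) ℚ./ 1) ≡ + ((j ℕ.∸ 1) ℕ.* y) ℚ./ 1
[1-2/p]*[p*y] (suc i) y (s≤s z≤n) = ℚₚ.toℚᵘ-injective (begin
  ℚ.toℚᵘ ((ℚ.1ℚ ℚ.- q) ℚ.* (+ (p ℕ.* y) ℚ./ 1))
    ≈⟨ ℚₚ.toℚᵘ-homo-* (ℚ.1ℚ ℚ.- q) (+ (p ℕ.* y) ℚ./ 1) ⟩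
  ℚ.toℚᵘ (ℚ.1ℚ ℚ.- q) ℚᵘ.* ℚ.toℚᵘ (+ (p ℕ.* y) ℚ./ 1)
    ≈⟨ ℚᵘₚ.*-cong (ℚᵘₚ.≃-trans (ℚₚ.toℚᵘ-homo-+ ℚ.1ℚ (ℚ.- q))
         (ℚᵘₚ.+-congʳ ℚᵘ.1ℚᵘ (ℚᵘₚ.≃-trans (ℚₚ.toℚᵘ-homo‿- q) (ℚᵘₚ.-‿cong (ℚₚ.toℚᵘ-fromℚᵘ (ℚᵘ.mkℚᵘ (+ 2) (suc i)))))))
         (ℚₚ.toℚᵘ-fromℚᵘ (ℚᵘ.mkℚᵘ (+ (p ℕ.* y)) 0)) ⟩
  (ℚᵘ.1ℚᵘ ℚᵘ.- ℚᵘ.mkℚᵘ (+ 2) (suc i)) ℚᵘ.* ℚᵘ.mkℚᵘ (+ (p ℕ.* y)) 0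
    ≈⟨ ℚᵘ.*≡* numerators ⟩
  ℚᵘ.mkℚᵘ (+ (i ℕ.* y)) 0
    ≈⟨ ℚₚ.toℚᵘ-fromℚᵘ (ℚᵘ.mkℚᵘ (+ (i ℕ.* y)) 0) ⟨
  ℚ.toℚᵘ (+ (i ℕ.* y) ℚ./ 1) ∎)
  where
  p = suc (suc i)
  q = + 2 ℚ./ p
  open ℚᵘₚ.≃-Reasoning
  numerators : (+ 1 ℤ.* + p ℤ.+ -[1+ 1 ] ℤ.* + 1) ℤ.* + (p ℕ.* y) ℤ.* + 1 ≡
               + (i ℕ.* y) ℤ.* + ((1 ℕ.* p) ℕ.* 1)
  numerators = E.begin
    (+ 1 ℤ.* + p ℤ.+ -[1+ 1 ]) ℤ.* + (p ℕ.* y) ℤ.* + 1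
      E.≡⟨ ≡.cong (λ z → (z ℤ.+ -[1+ 1 ]) ℤ.* + (p ℕ.* y) ℤ.* + 1) (ℤₚ.*-identityˡ (+ p)) ⟩
    -- As p is `suc (suc i)`, the integer p - 2 computes to `+ i`.
    + i ℤ.* + (p ℕ.* y) ℤ.* + 1
      E.≡⟨ ≡.cong (ℤ._* + 1) (≡.sym (ℤₚ.pos-* i (p ℕ.* y))) ⟩
    + (i ℕ.* (p ℕ.* y)) ℤ.* + 1
      E.≡⟨ ≡.sym (ℤₚ.pos-* (i ℕ.* (p ℕ.* y)) 1) ⟩
    + (i ℕ.* (p ℕ.* y) ℕ.* 1)
      E.≡⟨ ≡.cong +_ (solve 3 (λ i p y → i :* (p :* y) :* con 1 := i :* y :* ((con 1 :* p) :* con 1)) ≡.refl i p y) ⟩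
    + (i ℕ.* y ℕ.* ((1 ℕ.* p) ℕ.* 1))
      E.≡⟨ ℤₚ.pos-* (i ℕ.* y) ((1 ℕ.* p) ℕ.* 1) ⟩
    + (i ℕ.* y) ℤ.* + ((1 ℕ.* p) ℕ.* 1) E.∎
    where
    module E = ≡.≡-Reasoning
    open +-*-Solver

-- The fold starts at the full product. Generalising over the cofactor `x` lets the induction move p
-- into it and meet it with 1 - 2/p afterwards.
nProd-formula : ∀ P → All (λ j → 1 ℕ.≤ j) P → ∀ x →
  foldr (λ j q → (ℚ.1ℚ ℚ.- (+ 2 ℚ./ suc j)) ℚ.* q) (+ (x ℕ.* ∏suc P) ℚ./ 1) P ≡
  + (x ℕ.* ∏ℕ (ℕ._∸ 1) P) ℚ./ 1
nProd-formula []      []         x = ≡.refl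
nProd-formula (j ∷ P) (1≤j ∷ ps) x = begin
  f j (foldr f (+ (x ℕ.* (suc j ℕ.* ∏suc P)) ℚ./ 1) P)
    ≡⟨ ≡.cong (λ y → f j (foldr f (+ y ℚ./ 1) P)) (≡.sym (ℕₚ.*-assoc x (suc j) (∏suc P))) ⟩
  f j (foldr f (+ (x ℕ.* suc j ℕ.* ∏suc P) ℚ./ 1) P)
    ≡⟨ ≡.cong (f j) (nProd-formula P ps (x ℕ.* suc j)) ⟩
  f j (+ (x ℕ.* suc j ℕ.* ∏ℕ (ℕ._∸ 1) P) ℚ./ 1)
    ≡⟨ ≡.cong (λ y → f j (+ y ℚ./ 1)) (solve 3 (λ x p y → x :* p :* y := p :* (x :* y)) ≡.refl x (suc j) _) ⟩
  f j (+ (suc j ℕ.* (x ℕ.* ∏ℕ (ℕ._∸ 1) P)) ℚ./ 1)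
    ≡⟨ [1-2/p]*[p*y] j (x ℕ.* ∏ℕ (ℕ._∸ 1) P) 1≤j ⟩
  + ((j ℕ.∸ 1) ℕ.* (x ℕ.* ∏ℕ (ℕ._∸ 1) P)) ℚ./ 1
    ≡⟨ ≡.cong (λ y → + y ℚ./ 1) (solve 3 (λ x p y → p :* (x :* y) := x :* (p :* y)) ≡.refl x (j ℕ.∸ 1) _) ⟩
  + (x ℕ.* ∏ℕ (ℕ._∸ 1) (j ∷ P)) ℚ./ 1 ∎
  where
  f : ℕ → ℚ → ℚ
  f j q = (ℚ.1ℚ ℚ.- (+ 2 ℚ./ suc j)) ℚ.* q
  open ≡.≡-Reasoning
  open +-*-Solver

-- Polynomials

module Polynomials {c ℓ} (R : CommutativeRing c ℓ) where
  open Sums R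

  infix  4 _≋_
  infixl 7 _⊛_
  infixr 8 [x-_]·_

  _≋_ : Poly R → Poly R → Set ℓ
  _≋_ = _≈ₚ_ R

  _⊛_ : Poly R → Poly R → Poly R
  _⊛_ = _*ₚ_ R

  [x-_]·_ : Carrier → Poly R → Poly R
  [x- r ]· p = (- r ∷ 1# ∷ []) ⊛ p

  evalₚ-map : ∀ {A : Set} (f : A → Carrier) g n x →
    evalₚ R (map f (applyUpTo g n)) x ≈ Σ< n (λ k → f (g k) * x ^ k)
  evalₚ-map f g zero    x = refl
  evalₚ-map f g (suc n) x = +-cong (sym (*-identityʳ _)) (begin
    x * evalₚ R (map f (applyUpTo (g ∘ suc) n)) x      ≈⟨ *-congˡ (evalₚ-map f (g ∘ suc) n x) ⟩
    x * Σ< n (λ k → f (g (suc k)) * x ^ k)             ≈⟨ *-distribˡ-Σ< n x _ ⟩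
    Σ< n (λ k → x * (f (g (suc k)) * x ^ k))
      ≈⟨ Σ<-cong n (λ k _ → solve 3 (λ a b c → a :* (b :* c) := b :* (a :* c)) refl _ _ _) ⟩
    Σ< n (λ k → f (g (suc k)) * x ^ suc k)             ∎)

  coeff-+ₚ : ∀ p q i → coeff R (_+ₚ_ R p q) i ≈ coeff R p i + coeff R q i
  coeff-+ₚ []      q       i       = sym (+-identityˡ _)
  coeff-+ₚ (x ∷ p) []      i       = sym (+-identityʳ _)
  coeff-+ₚ (x ∷ p) (y ∷ q) zero    = refl
  coeff-+ₚ (x ∷ p) (y ∷ q) (suc i) = coeff-+ₚ p q i

  coeff-scaleₚ : ∀ a p i → coeff R (scaleₚ R a p) i ≈ a * coeff R p i
  coeff-scaleₚ a []      i       = sym (zeroʳ a)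
  coeff-scaleₚ a (x ∷ p) zero    = refl
  coeff-scaleₚ a (x ∷ p) (suc i) = coeff-scaleₚ a p i

  convolution : Poly R → Poly R → ℕ → Carrier
  convolution p q i = Σ< (suc i) (λ k → coeff R p k * coeff R q (i ℕ.∸ k))

  coeff-*ₚ : ∀ p q i → coeff R (p ⊛ q) i ≈ convolution p q i
  coeff-*ₚ []      q i = sym (Σ<-zero (suc i) (λ k _ → zeroˡ (coeff R q (i ℕ.∸ k))))
  coeff-*ₚ (x ∷ p) q i =
    trans (coeff-+ₚ (scaleₚ R x q) (0# ∷ p ⊛ q) i) (+-cong (coeff-scaleₚ x q i) (shifted i))
    where
    shifted : ∀ i → coeff R (0# ∷ p ⊛ q) i ≈ Σ< i (λ k → coeff R p k * coeff R q (i ℕ.∸ suc k))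
    shifted zero    = refl
    shifted (suc i) = coeff-*ₚ p q i

  coeff-[x-r]*-zero : ∀ r p → coeff R ([x- r ]· p) 0 ≈ - r * coeff R p 0
  coeff-[x-r]*-zero r p = trans (coeff-*ₚ (- r ∷ 1# ∷ []) p 0) (+-identityʳ _)

  coeff-[x-r]*-suc : ∀ r p i →
    coeff R ([x- r ]· p) (suc i) ≈ - r * coeff R p (suc i) + coeff R p i
  coeff-[x-r]*-suc r p i = trans (coeff-*ₚ (- r ∷ 1# ∷ []) p (suc i))
    (+-congˡ (trans (+-cong (*-identityˡ _) (Σ<-zero i (λ k _ → zeroˡ _))) (+-identityʳ _)))

  -- The coefficient recursion determines a multiple of x - r; congruence, associativity and the
  -- factor theorem all reduce to checking it.
  [x-r]*-unique : ∀ r p q → coeff R p 0 ≈ - r * coeff R q 0 →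
    (∀ i → coeff R p (suc i) ≈ - r * coeff R q (suc i) + coeff R q i) →
    p ≋ [x- r ]· q
  [x-r]*-unique r p q eq₀ eq₊ zero    = trans eq₀ (sym (coeff-[x-r]*-zero r q))
  [x-r]*-unique r p q eq₀ eq₊ (suc i) = trans (eq₊ i) (sym (coeff-[x-r]*-suc r q i))

  [x-r]*-cong : ∀ r p q → p ≋ q →
    [x- r ]· p ≋ [x- r ]· q
  [x-r]*-cong r p q eq = [x-r]*-unique r ([x- r ]· p) q
    (trans (coeff-[x-r]*-zero r p) (*-congˡ (eq 0)))
    (λ i → trans (coeff-[x-r]*-suc r p i) (+-cong (*-congˡ (eq (suc i))) (eq i)))

  -- Convolution with `q` is linear in the coefficients of its first factor, so the recursion for (x
  -- - r) p carries over to the product.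
  [x-r]*-assoc : ∀ r p q →
    ([x- r ]· p) ⊛ q ≋ [x- r ]· (p ⊛ q)
  [x-r]*-assoc r p q = [x-r]*-unique r (L ⊛ q) (p ⊛ q)
    (begin
      coeff R (L ⊛ q) 0              ≈⟨ coeff-*ₚ L q 0 ⟩
      coeff R L 0 * q′ 0 + 0#             ≈⟨ +-congʳ (*-congʳ (coeff-[x-r]*-zero r p)) ⟩
      (- r * p′ 0) * q′ 0 + 0#
        ≈⟨ solve 3 (λ s a b → (s :* a) :* b :+ con 0 := s :* (a :* b :+ con 0)) refl _ _ _ ⟩
      - r * (p′ 0 * q′ 0 + 0#)            ≈⟨ *-congˡ (coeff-*ₚ p q 0) ⟨
      - r * coeff R (p ⊛ q) 0        ∎)
    (λ i → begin
      coeff R (L ⊛ q) (suc i)        ≈⟨ coeff-*ₚ L q (suc i) ⟩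
      coeff R L 0 * q′ (suc i) + Σ< (suc i) (λ k → coeff R L (suc k) * q′ (i ℕ.∸ k))
        ≈⟨ +-cong (*-congʳ (coeff-[x-r]*-zero r p)) (Σ<-cong (suc i) (λ k _ →
             trans (*-congʳ (coeff-[x-r]*-suc r p k))
               (solve 4 (λ s a b c → (s :* a :+ b) :* c := s :* (a :* c) :+ b :* c)
                 refl (- r) (p′ (suc k)) (p′ k) (q′ (i ℕ.∸ k))))) ⟩
      (- r * p′ 0) * q′ (suc i) +
        Σ< (suc i) (λ k → - r * (p′ (suc k) * q′ (i ℕ.∸ k)) + p′ k * q′ (i ℕ.∸ k))
        ≈⟨ +-cong (*-assoc _ _ _) (trans
             (Σ<-distrib-+ (suc i) (λ k → - r * (p′ (suc k) * q′ (i ℕ.∸ k))) (λ k → p′ k * q′ (i ℕ.∸ k)))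
             (+-congʳ (sym (*-distribˡ-Σ< (suc i) (- r) (λ k → p′ (suc k) * q′ (i ℕ.∸ k)))))) ⟩
      - r * (p′ 0 * q′ (suc i)) +
        (- r * Σ< (suc i) (λ k → p′ (suc k) * q′ (i ℕ.∸ k)) + convolution p q i)
        ≈⟨ solve 4 (λ s a b c → s :* a :+ (s :* b :+ c) := s :* (a :+ b) :+ c) refl _ _ _ _ ⟩
      - r * convolution p q (suc i) + convolution p q i
        ≈⟨ +-cong (*-congˡ (coeff-*ₚ p q (suc i))) (coeff-*ₚ p q i) ⟨
      - r * coeff R (p ⊛ q) (suc i) + coeff R (p ⊛ q) i ∎)
    where
    L = [x- r ]· p
    p′ = coeff R p
    q′ = coeff R q

  -- Synthetic division by x − r: the coefficients are the intermediate values of Horner's scheme.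
  quotient : Carrier → Poly R → Poly R
  quotient r []      = []
  quotient r (a ∷ p) = evalₚ R p r ∷ quotient r p

  -r*x+r*x≈0 : ∀ r x → - r * x + r * x ≈ 0#
  -r*x+r*x≈0 r x = trans (sym (distribʳ x (- r) r)) (trans (*-congʳ (-‿inverseˡ r)) (zeroˡ x))

  quotient-zero : ∀ r p → coeff R p 0 ≈ - r * coeff R (quotient r p) 0 + evalₚ R p r
  quotient-zero r []      = sym (trans (+-identityʳ _) (zeroʳ _))
  quotient-zero r (a ∷ p) = begin
    a                                                 ≈⟨ +-identityʳ a ⟨
    a + 0#                                            ≈⟨ +-congˡ (-r*x+r*x≈0 r _) ⟨
    a + (- r * evalₚ R p r + r * evalₚ R p r)
      ≈⟨ solve 3 (λ a b c → a :+ (b :+ c) := b :+ (a :+ c)) refl _ _ _ ⟩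
    - r * evalₚ R p r + (a + r * evalₚ R p r)         ∎

  quotient-suc : ∀ r p i →
    coeff R p (suc i) ≈ - r * coeff R (quotient r p) (suc i) + coeff R (quotient r p) i
  quotient-suc r []      i       = sym (trans (+-identityʳ _) (zeroʳ _))
  -- The constant coefficient of the quotient of `a ∷ p` is p(r), the remainder of the tail.
  quotient-suc r (a ∷ p) zero    = quotient-zero r p
  quotient-suc r (a ∷ p) (suc i) = quotient-suc r p i

  factor-theorem : ∀ r p → evalₚ R p r ≈ 0# →
    p ≋ [x- r ]· quotient r p
  factor-theorem r p pr≈0 = [x-r]*-unique r p (quotient r p)
    (trans (quotient-zero r p) (trans (+-congˡ pr≈0) (+-identityʳ _))) (quotient-suc r p)

  evalₚ-quotient : ∀ r p x → evalₚ R p x ≈ (x - r) * evalₚ R (quotient r p) x + evalₚ R p r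
  evalₚ-quotient r []      x = sym (trans (+-identityʳ _) (zeroʳ _))
  evalₚ-quotient r (a ∷ p) x = begin
    a + x * evalₚ R p x                                ≈⟨ +-congˡ (*-congˡ (evalₚ-quotient r p x)) ⟩
    a + x * ((x - r) * q + y)                          ≈⟨ +-identityʳ _ ⟨
    a + x * ((x - r) * q + y) + 0#                     ≈⟨ +-congˡ (-r*x+r*x≈0 r y) ⟨
    a + x * ((x - r) * q + y) + (- r * y + r * y)
      -- The solver is one for semirings, so -r enters as an independent variable `s`; the zero -r y
      -- + r y was inserted to balance the two sides.
      ≈⟨ solve 6 (λ x r a y q s → a :+ x :* ((x :+ s) :* q :+ y) :+ (s :* y :+ r :* y)
           := (x :+ s) :* (y :+ x :* q) :+ (a :+ r :* y)) refl x r a y q (- r) ⟩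
    (x - r) * (y + x * q) + (a + r * y)                ∎
    where
    q = evalₚ R (quotient r p) x
    y = evalₚ R p r

  module _ (domain : IsIntegralDomain R) where

    -- Divide out one root r at a time. At any other root s of p, (s - r) q(s) = 0 for the quotient
    -- q, and in a domain s is then a root of q.
    distinct-roots⇒∣ₚ : ∀ {A : Set} (root : A → Carrier) {J} p →
      AllPairs (λ i j → ¬ (root j ≈ root i)) J → All (λ j → evalₚ R p (root j) ≈ 0#) J →
      _∣ₚ_ R (foldr (λ j q → [x- root j ]· q) (1# ∷ []) J) p
    distinct-roots⇒∣ₚ root p [] [] = p , λ i → sym (begin
      coeff R ((1# ∷ []) ⊛ p) i     ≈⟨ coeff-*ₚ (1# ∷ []) p i ⟩
      convolution (1# ∷ []) p i
        ≈⟨ +-cong (*-identityˡ _) (Σ<-zero i (λ k _ → zeroˡ _)) ⟩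
      coeff R p i + 0#                   ≈⟨ +-identityʳ _ ⟩
      coeff R p i                        ∎)
    distinct-roots⇒∣ₚ root {j ∷ J} p (distinct ∷ distincts) (zero-j ∷ zeros) =
      s , λ i → begin
        coeff R p i                                          ≈⟨ factor-theorem r p zero-j i ⟩
        coeff R ([x- r ]· q) i                 ≈⟨ [x-r]*-cong r q (D ⊛ s) q≈D*s i ⟩
        coeff R ([x- r ]· (D ⊛ s)) i      ≈⟨ [x-r]*-assoc r D s i ⟨
        coeff R (([x- r ]· D) ⊛ s) i      ∎
      where
      r = root j
      q = quotient r p
      D = foldr (λ j q → [x- root j ]· q) (1# ∷ []) J
      quotient-root : ∀ {i} → ¬ (root i ≈ r) × evalₚ R p (root i) ≈ 0# → evalₚ R q (root i) ≈ 0#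
      quotient-root {i} (i≉r , pi≈0) with proj₂ domain (root i - r) (evalₚ R q (root i)) (begin
        (root i - r) * evalₚ R q (root i)                   ≈⟨ +-identityʳ _ ⟨
        (root i - r) * evalₚ R q (root i) + 0#              ≈⟨ +-congˡ zero-j ⟨
        (root i - r) * evalₚ R q (root i) + evalₚ R p r     ≈⟨ evalₚ-quotient r p (root i) ⟨
        evalₚ R p (root i)                                  ≈⟨ pi≈0 ⟩
        0#                                                  ∎)
      ... | inj₁ eq = contradiction (x∙y⁻¹≈ε⇒x≈y _ _ eq) i≉r
      ... | inj₂ eq = eq
      ih = distinct-roots⇒∣ₚ root q distincts (All.zipWith quotient-root (distinct , zeros))
      s = proj₁ ih
      q≈D*s = proj₂ ih

-- Ramanujan sums

module Integers {c ℓ} (R : CommutativeRing c ℓ) where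
  open Sums R

  ι-homo-⊖ : ∀ m n → ι R (m ℤ.⊖ n) ≈ ιℕ R m - ιℕ R n
  ι-homo-⊖ m       zero    = sym (trans (+-congˡ -0#≈0#) (+-identityʳ _))
  ι-homo-⊖ zero    (suc n) = sym (+-identityˡ _)
  ι-homo-⊖ (suc m) (suc n) = begin
    ι R (suc m ℤ.⊖ suc n)                 ≡⟨ ≡.cong (ι R) (ℤₚ.[1+m]⊖[1+n]≡m⊖n m n) ⟩
    ι R (m ℤ.⊖ n)                         ≈⟨ ι-homo-⊖ m n ⟩
    ιℕ R m - ιℕ R n                       ≈⟨ +-congʳ (xyx⁻¹≈y 1# (ιℕ R m)) ⟨
    (1# + ιℕ R m - 1#) - ιℕ R n           ≈⟨ +-assoc _ _ _ ⟩
    (1# + ιℕ R m) + (- 1# - ιℕ R n)       ≈⟨ +-congˡ (-‿+-comm 1# (ιℕ R n)) ⟩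
    (1# + ιℕ R m) - (1# + ιℕ R n)         ∎

  ι-homo-+ : ∀ i j → ι R (i ℤ.+ j) ≈ ι R i + ι R j
  ι-homo-+ (+ m)    (+ n)    = ιℕ-homo-+ m n
  ι-homo-+ (+ m)    -[1+ n ] = ι-homo-⊖ m (suc n)
  ι-homo-+ -[1+ m ] (+ n)    = trans (ι-homo-⊖ n (suc m)) (+-comm _ _)
  ι-homo-+ -[1+ m ] -[1+ n ] = begin
    - ιℕ R (suc (suc (m ℕ.+ n)))          ≡⟨ ≡.cong (λ k → - ιℕ R (suc k)) (ℕₚ.+-suc m n) ⟨
    - ιℕ R (suc m ℕ.+ suc n)              ≈⟨ -‿cong (ιℕ-homo-+ (suc m) (suc n)) ⟩
    - (ιℕ R (suc m) + ιℕ R (suc n))       ≈⟨ -‿+-comm _ _ ⟨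
    - ιℕ R (suc m) - ιℕ R (suc n)         ∎

  ι-homo-neg : ∀ i → ι R (ℤ.- i) ≈ - ι R i
  ι-homo-neg (+ zero)  = sym -0#≈0#
  ι-homo-neg (+ suc n) = refl
  ι-homo-neg -[1+ n ]  = sym (-‿involutive _)

  -- Each step moves one factor -1 from the power into `i`, so only compatibility of `ι` with
  -- negation enters.
  ι-homo-*[-1]^ : ∀ i k → ι R (i ℤ.* (ℤ.- + 1) ℤ.^ k) ≈ ι R i * (- 1#) ^ k
  ι-homo-*[-1]^ i zero    = trans (reflexive (≡.cong (ι R) (ℤₚ.*-identityʳ i))) (sym (*-identityʳ _))
  ι-homo-*[-1]^ i (suc k) = begin
    ι R (i ℤ.* ((ℤ.- + 1) ℤ.* (ℤ.- + 1) ℤ.^ k))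
      ≡⟨ ≡.cong (ι R) (≡.trans (≡.sym (ℤₚ.*-assoc i (ℤ.- + 1) _))
           (≡.cong (ℤ._* (ℤ.- + 1) ℤ.^ k) (≡.trans (ℤₚ.*-comm i (ℤ.- + 1)) (ℤₚ.-1*i≡-i i)))) ⟩
    ι R (ℤ.- i ℤ.* (ℤ.- + 1) ℤ.^ k)      ≈⟨ ι-homo-*[-1]^ (ℤ.- i) k ⟩
    ι R (ℤ.- i) * (- 1#) ^ k              ≈⟨ *-congʳ (trans (ι-homo-neg i) (sym (-1*x≈-x _))) ⟩
    - 1# * ι R i * (- 1#) ^ k
      ≈⟨ solve 3 (λ a b c → a :* b :* c := b :* (a :* c)) refl _ _ _ ⟩
    ι R i * (- 1#) ^ suc k                ∎

  ι-sumℤ : ∀ {A : Set} (f : A → ℤ) g n →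
    ι R (sumℤ (map f (applyUpTo g n))) ≈ Σ< n (λ k → ι R (f (g k)))
  ι-sumℤ f g zero    = refl
  ι-sumℤ f g (suc n) = trans (ι-homo-+ (f (g 0)) _) (+-congˡ (ι-sumℤ f (g ∘ suc) n))

  ι-T-at-minus1 : ∀ n a → ι R (T-at-minus1 n a) ≈ evalₚ R (Tpoly R n a) (- 1#)
  ι-T-at-minus1 n a = begin
    ι R (T-at-minus1 n a)                              ≈⟨ ι-sumℤ _ id n ⟩
    Σ< n (λ k → ι R (+ ℤ.∣ a k ∣ ℤ.* (ℤ.- + 1) ℤ.^ k))
      ≈⟨ Σ<-cong n (λ k _ → ι-homo-*[-1]^ (+ ℤ.∣ a k ∣) k) ⟩
    Σ< n (λ k → ιℕ R ℤ.∣ a k ∣ * (- 1#) ^ k)           ≈⟨ Polynomials.evalₚ-map R _ id n (- 1#) ⟨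
    evalₚ R (Tpoly R n a) (- 1#)                       ∎

  infix 4 _≈±_
  -- A substitute for |x| = m, since `R` carries no absolute value; it is multiplicative, and
  -- `CharZero` turns it into a true absolute value for integers.
  _≈±_ : Carrier → ℕ → Set ℓ
  x ≈± m = x ≈ ιℕ R m ⊎ x ≈ - ιℕ R m

  ≈±-resp : ∀ {x y} m → x ≈ y → y ≈± m → x ≈± m
  ≈±-resp m x≈y (inj₁ eq) = inj₁ (trans x≈y eq)
  ≈±-resp m x≈y (inj₂ eq) = inj₂ (trans x≈y eq)

  ≈±-* : ∀ {x y} m n → x ≈± m → y ≈± n → x * y ≈± m ℕ.* n
  ≈±-* m n (inj₁ p) (inj₁ q) = inj₁ (trans (*-cong p q) (sym (ιℕ-homo-* m n)))
  ≈±-* m n (inj₁ p) (inj₂ q) =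
    inj₂ (trans (*-cong p q) (trans (sym (-‿distribʳ-* _ _)) (-‿cong (sym (ιℕ-homo-* m n)))))
  ≈±-* m n (inj₂ p) (inj₁ q) =
    inj₂ (trans (*-cong p q) (trans (sym (-‿distribˡ-* _ _)) (-‿cong (sym (ιℕ-homo-* m n)))))
  ≈±-* {x} {y} m n (inj₂ p) (inj₂ q) = inj₁ (begin
    x * y                    ≈⟨ *-cong p q ⟩
    - ιℕ R m * - ιℕ R n      ≈⟨ -‿distribˡ-* _ _ ⟨
    - (ιℕ R m * - ιℕ R n)    ≈⟨ -‿cong (sym (-‿distribʳ-* _ _)) ⟩
    - - (ιℕ R m * ιℕ R n)    ≈⟨ -‿involutive _ ⟩
    ιℕ R m * ιℕ R n          ≈⟨ ιℕ-homo-* m n ⟨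
    ιℕ R (m ℕ.* n)           ∎)

  ∏-≈± : ∀ {f} g P → (∀ j → f j ≈± g j) → ∏ f P ≈± ∏ℕ g P
  ∏-≈± g []      eq = inj₁ (sym (+-identityʳ 1#))
  ∏-≈± g (j ∷ P) eq = ≈±-* (g j) (∏ℕ g P) (eq j) (∏-≈± g P eq)

  ∏-ιℕ : ∀ (f : ℕ → ℕ) P → ∏ (ιℕ R ∘ f) P ≈ ιℕ R (∏ℕ f P)
  ∏-ιℕ f []      = sym (+-identityʳ 1#)
  ∏-ιℕ f (j ∷ P) = trans (*-congˡ (∏-ιℕ f P)) (sym (ιℕ-homo-* (f j) (∏ℕ f P)))

  ∏-one : ∀ {f P} → All (λ j → f j ≈ 1#) P → ∏ f P ≈ 1#
  ∏-one []         = refl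
  ∏-one (eq ∷ eqs) = trans (*-cong eq (∏-one eqs)) (*-identityˡ 1#)

  ∏-zero : ∀ {f j P} → j ∈ P → f j ≈ 0# → ∏ f P ≈ 0#
  ∏-zero (here ≡.refl) eq = trans (*-congʳ eq) (zeroˡ _)
  ∏-zero (there j∈P)   eq = trans (*-congˡ (∏-zero j∈P eq)) (zeroʳ _)

  1+[x-1]≈x : ∀ x → 1# + (x - 1#) ≈ x
  1+[x-1]≈x x = trans (sym (+-assoc 1# x (- 1#))) (xyx⁻¹≈y 1# x)

  ∣∣-unique : CharZero R → ∀ i m → ι R i ≈± m → ℤ.∣ i ∣ ≡ m
  ∣∣-unique charZero i m (inj₁ eq) = ≡.cong ℤ.∣_∣ (charZero i (+ m) eq)
  ∣∣-unique charZero i m (inj₂ eq) = ≡.trans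
    (≡.cong ℤ.∣_∣ (charZero i (ℤ.- + m) (trans eq (sym (ι-homo-neg (+ m)))))) (ℤₚ.∣-i∣≡∣i∣ (+ m))

  sumR-filter : ∀ {A : Set} {p} {Q : Pred A p} (Q? : Decidable Q) (f : A → Carrier) (h : ℕ → A) g n →
    sumR R (map f (filter Q? (map h (applyUpTo g n)))) ≈
    Σ< n (λ k → (if does (Q? (h (g k))) then 1# else 0#) * f (h (g k)))
  sumR-filter Q? f h g zero    = refl
  sumR-filter Q? f h g (suc n) with does (Q? (h (g 0)))
  ... | true  = +-cong (sym (*-identityˡ _)) (sumR-filter Q? f h (g ∘ suc) n)
  ... | false = trans (sumR-filter Q? f h (g ∘ suc) n)
                      (sym (trans (+-congʳ (zeroˡ _)) (+-identityˡ _)))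

  sumR-ones : ∀ {A : Set} (f : A → Carrier) xs → (∀ x → f x ≈ 1#) → sumR R (map f xs) ≈ ιℕ R (length xs)
  sumR-ones f []       ones = refl
  sumR-ones f (x ∷ xs) ones = +-cong (ones x) (sumR-ones f xs ones)

-- The absolute value of p [p∣i] − 1.
absFactor : ℕ → ℕ → ℕ
absFactor i j = if-∣ (suc j) i j 1

module RamanujanSums {c ℓ} (R : CommutativeRing c ℓ) (domain : IsIntegralDomain R) (charZero : CharZero R)
                     (n N-1 : ℕ) (n≡N*Q : n ≡ suc N-1 ℕ.* ∏suc (primeDivisorsPred n))
                     .{{n≢0 : ℕ.NonZero n}} where
  open Roots R domain charZero
  open Integers R
  open PrimeDivisors n

  -- `Q` is the radical of n and `N` its cofactor, given as a successor because `Σ<-multiples` takes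
  -- steps of that form.
  N Q : ℕ
  N = suc N-1
  Q = ∏suc P

  n≡Q*N : n ≡ Q ℕ.* N
  n≡Q*N = ≡.trans n≡N*Q (ℕₚ.*-comm N Q)

  neg1 : ℕ → Carrier
  neg1 _ = - 1#

  -- At weight -1 the factor of p is 0 if p divides k and 1 otherwise, and non-coprimality to n is
  -- always witnessed by a prime of n.
  coprime-indicator : ∀ k → (if does (coprime? k n) then 1# else 0#) ≈ ∏ (localFactor neg1 k) P
  coprime-indicator k = indicator (coprime? k n)
    where
    indicator : (cop? : Dec (Coprime k n)) → (if does cop? then 1# else 0#) ≈ ∏ (localFactor neg1 k) P
    indicator (yes cop) = sym (∏-one (All.map (λ j∤k → reflexive (if-∣-no j∤k)) (coprime⇒P∤ cop)))
    indicator (no ¬cop) = let j , j∈P , j∣k = ¬coprime⇒P∣ ¬cop in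
      sym (∏-zero j∈P (trans (reflexive (if-∣-yes j∣k)) (-‿inverseʳ 1#)))

  module _ {ζ} (order : HasOrder n ζ) where

    order-Q : HasOrder Q (ζ ^ N)
    order-Q = order-^ N (≡.subst (λ m → HasOrder m ζ) n≡N*Q order)

    ramanujanSum≈twistedSum : ∀ k → ramanujanSum R n ζ k ≈ twistedSum neg1 P n (ζ ^ k)
    ramanujanSum≈twistedSum k = begin
      ramanujanSum R n ζ k
        ≈⟨ sumR-filter (λ j → coprime? j n) (λ j → ζ ^ (j ℕ.* k)) suc id n ⟩
      Σ< n (λ i → (if does (coprime? (suc i) n) then 1# else 0#) * ζ ^ (suc i ℕ.* k))
        ≈⟨ Σ<-cong n (λ i _ → *-cong (coprime-indicator (suc i)) (^-assoc ζ (suc i) k)) ⟩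
      Σ< n (f ∘ suc)
        -- The units are taken from 1, ..., n; the summand agrees at n and 0, so the sum may start
        -- at 0.
        ≈⟨ Σ<-rotate n f (*-cong (reflexive f[n]≡f[0]) (trans (^-comm ζ k n) (1^k≈1 k (proj₁ order)))) ⟩
      Σ< n f ∎
      where
      f : ℕ → Carrier
      f i = ∏ (localFactor neg1 i) P * (ζ ^ k) ^ i
      f[n]≡f[0] : ∏ (localFactor neg1 n) P ≡ ∏ (localFactor neg1 0) P
      f[n]≡f[0] = ≡.trans (≡.cong (λ m → ∏ (localFactor neg1 m) P) (≡.sym (ℕₚ.+-identityʳ n)))
                          (local-periodic neg1 P∣n 0)

    ramanujanSum-product : ∀ k →
      ramanujanSum R n ζ k ≈ geometric N ((ζ ^ k) ^ Q) * twistedSum neg1 P Q (ζ ^ k)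
    ramanujanSum-product k = begin
      ramanujanSum R n ζ k                     ≈⟨ ramanujanSum≈twistedSum k ⟩
      twistedSum neg1 P n (ζ ^ k)              ≡⟨ ≡.cong (λ m → twistedSum neg1 P m (ζ ^ k)) n≡N*Q ⟩
      twistedSum neg1 P (N ℕ.* Q) (ζ ^ k)
        ≈⟨ Σ<-periodic N Q (ζ ^ k) (λ i → ∏ (localFactor neg1 i) P) (local-periodic neg1 (∣∏suc P)) ⟩
      geometric N ((ζ ^ k) ^ Q) * twistedSum neg1 P Q (ζ ^ k) ∎

    -- ζ^{kQ} is an N-th root of unity, equal to 1 only if NQ divides kQ; otherwise its geometric
    -- sum is 0.
    ramanujanSum-vanishes : ∀ {k} → N ∤ k → ramanujanSum R n ζ k ≈ 0#
    ramanujanSum-vanishes {k} N∤k =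
      trans (ramanujanSum-product k) (trans (*-congʳ (geometric-root N root nontrivial)) (zeroˡ _))
      where
      root : ((ζ ^ k) ^ Q) ^ N ≈ 1#
      root = begin
        ((ζ ^ k) ^ Q) ^ N      ≈⟨ ^-assoc (ζ ^ k) N Q ⟨
        (ζ ^ k) ^ (N ℕ.* Q)    ≡⟨ ≡.cong ((ζ ^ k) ^_) n≡N*Q ⟨
        (ζ ^ k) ^ n            ≈⟨ ^-comm ζ k n ⟩
        (ζ ^ n) ^ k            ≈⟨ 1^k≈1 k (proj₁ order) ⟩
        1#                     ∎
      nontrivial : ¬ ((ζ ^ k) ^ Q ≈ 1#)
      nontrivial eq = N∤k (*-cancelʳ-∣ Q {{∏suc-nonZero P}}
        (≡.subst (_∣ k ℕ.* Q) n≡N*Q (proj₂ order (k ℕ.* Q) (trans (^-assocʳ ζ k Q) eq))))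

    ramanujanSum-multiple : ∀ i → ramanujanSum R n ζ (i ℕ.* N) ≈ ιℕ R N * ∏ (dualFactor neg1 i) P
    ramanujanSum-multiple i = trans (ramanujanSum-product (i ℕ.* N)) (*-cong
      (geometric-1 N (begin
        (ζ ^ (i ℕ.* N)) ^ Q     ≈⟨ ^-cong Q (^-assoc ζ i N) ⟩
        ((ζ ^ N) ^ i) ^ Q       ≈⟨ ^-comm (ζ ^ N) i Q ⟩
        ((ζ ^ N) ^ Q) ^ i       ≈⟨ 1^k≈1 i (proj₁ order-Q) ⟩
        1#                      ∎))
      (trans (twistedSum-cong neg1 P Q (^-assoc ζ i N)) (twistedSum-root neg1 P-independent order-Q i)))

    ramanujanSum-zero : ramanujanSum R n ζ 0 ≈ ιℕ R (φ n)
    ramanujanSum-zero = sumR-ones (λ j → ζ ^ (j ℕ.* 0)) (unitsMod n)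
      (λ j → reflexive (≡.cong (ζ ^_) (ℕₚ.*-zeroʳ j)))

  -- w_p = p − 2, written in terms of j = p − 1.
  weight : ℕ → Carrier
  weight j = ιℕ R j - 1#

  dualFactor-neg1 : ∀ i j → dualFactor neg1 i j ≈± absFactor i j
  dualFactor-neg1 i j with does (suc j ∣? i)
  ... | true  = inj₁ (trans (+-assoc _ _ _) (1+[x-1]≈x (ιℕ R j)))
  ... | false = inj₂ (-‿cong (sym (+-identityʳ 1#)))

  localFactor-weight : ∀ i j → localFactor weight i j ≈ ιℕ R (absFactor i j)
  localFactor-weight i j with does (suc j ∣? i)
  ... | true  = 1+[x-1]≈x (ιℕ R j)
  ... | false = sym (+-identityʳ 1#)

  -- Absolute values of the Ramanujan sums and values of T_n

  module Table {ζ} (order : HasOrder n ζ) (a : ℕ → ℤ) (table : IsRamanujanTable R n ζ a) where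

    i*N<n : ∀ {i} → i ℕ.< Q → i ℕ.* N ℕ.< n
    i*N<n {i} i<Q = ≡.subst (i ℕ.* N ℕ.<_) (≡.sym n≡Q*N) (ℕₚ.*-monoˡ-< N i<Q)

    ∣a∣-multiple : ∀ i → i ℕ.< Q → ℤ.∣ a (i ℕ.* N) ∣ ≡ N ℕ.* ∏ℕ (absFactor i) P
    ∣a∣-multiple i i<Q = ∣∣-unique charZero (a (i ℕ.* N)) _ (≈±-resp (N ℕ.* ∏ℕ (absFactor i) P)
      (trans (table (i ℕ.* N) (i*N<n i<Q)) (ramanujanSum-multiple order i))
      (≈±-* N (∏ℕ (absFactor i) P) (inj₁ refl) (∏-≈± (absFactor i) P (dualFactor-neg1 i))))

    ∣a∣-vanishes : ∀ k → k ℕ.< n → N ∤ k → ℤ.∣ a k ∣ ≡ 0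
    ∣a∣-vanishes k k<n N∤k =
      ∣∣-unique charZero (a k) 0 (inj₁ (trans (table k k<n) (ramanujanSum-vanishes order N∤k)))

    -- Evaluate c_n(0) twice: it counts the units, and it is the product formula at i = 0, where
    -- `absFactor 0 j` computes to j because every p divides 0.
    φ-formula : φ n ≡ N ℕ.* ∏ℕ id P
    φ-formula = ≡.trans
      (≡.sym (∣∣-unique charZero (a 0) (φ n) (inj₁ (trans (table 0 (ℕ.>-nonZero⁻¹ n)) (ramanujanSum-zero order)))))
      (∣a∣-multiple 0 (ℕ.>-nonZero⁻¹ Q {{∏suc-nonZero P}}))

    -- Only multiples of N carry nonzero coefficients, and each absolute factor, p - 1 or 1, equals
    -- 1 + (p - 2) [p∣i]. The point x is arbitrary, so -1 is covered for odd n too.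
    T≈twistedSum : ∀ x → evalₚ R (Tpoly R n a) x ≈ ιℕ R N * twistedSum weight P Q (x ^ N)
    T≈twistedSum x = begin
      evalₚ R (Tpoly R n a) x                          ≈⟨ Polynomials.evalₚ-map R _ id n x ⟩
      Σ< n t                                           ≈⟨ Σ<-cong n sparse ⟩
      Σ< n (λ k → if-∣ N k (t k) 0#)
        ≡⟨ ≡.cong (λ m → Σ< m (λ k → if-∣ N k (t k) 0#)) n≡Q*N ⟩
      Σ< (Q ℕ.* N) (λ k → if-∣ N k (t k) 0#)           ≈⟨ Σ<-multiples Q N-1 t ⟩
      Σ< Q (λ i → t (i ℕ.* N))                         ≈⟨ Σ<-cong Q multiple ⟩
      Σ< Q (λ i → ιℕ R N * (∏ (localFactor weight i) P * (x ^ N) ^ i))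
        ≈⟨ *-distribˡ-Σ< Q (ιℕ R N) _ ⟨
      ιℕ R N * twistedSum weight P Q (x ^ N)           ∎
      where
      t : ℕ → Carrier
      t k = ιℕ R ℤ.∣ a k ∣ * x ^ k
      sparse : ∀ k → k ℕ.< n → t k ≈ if-∣ N k (t k) 0#
      sparse k k<n with N ∣? k
      ... | yes N∣k = reflexive (≡.sym (if-∣-yes N∣k))
      ... | no  N∤k = begin
        t k                  ≡⟨ ≡.cong (λ y → ιℕ R y * x ^ k) (∣a∣-vanishes k k<n N∤k) ⟩
        0# * x ^ k           ≈⟨ zeroˡ _ ⟩
        0#                   ≡⟨ if-∣-no N∤k ⟨
        if-∣ N k (t k) 0#    ∎
      multiple : ∀ i → i ℕ.< Q → t (i ℕ.* N) ≈ ιℕ R N * (∏ (localFactor weight i) P * (x ^ N) ^ i)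
      multiple i i<Q = begin
        ιℕ R ℤ.∣ a (i ℕ.* N) ∣ * x ^ (i ℕ.* N)
          ≈⟨ *-cong (reflexive (≡.cong (ιℕ R) (∣a∣-multiple i i<Q))) (^-assoc x i N) ⟩
        ιℕ R (N ℕ.* ∏ℕ (absFactor i) P) * (x ^ N) ^ i
          ≈⟨ *-congʳ (ιℕ-homo-* N (∏ℕ (absFactor i) P)) ⟩
        ιℕ R N * ιℕ R (∏ℕ (absFactor i) P) * (x ^ N) ^ i
          ≈⟨ *-assoc _ _ _ ⟩
        ιℕ R N * (ιℕ R (∏ℕ (absFactor i) P) * (x ^ N) ^ i)
          ≈⟨ *-congˡ (*-congʳ (trans (∏-cong (All.universal (localFactor-weight i) P)) (∏-ιℕ (absFactor i) P))) ⟨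
        ιℕ R N * (∏ (localFactor weight i) P * (x ^ N) ^ i) ∎

    T-at-root : ∀ {η} → HasOrder n η → ∀ k →
      evalₚ R (Tpoly R n a) (η ^ k) ≈ ιℕ R N * ∏ (dualFactor weight k) P
    T-at-root {η} η-order k = trans (T≈twistedSum (η ^ k)) (*-congˡ
      (trans (twistedSum-cong weight P Q (^-comm η k N))
             (twistedSum-root weight P-independent (order-Q η-order) k)))

    T-cong : ∀ {x y} → x ≈ y → evalₚ R (Tpoly R n a) x ≈ evalₚ R (Tpoly R n a) y
    T-cong x≈y = trans (T≈twistedSum _)
      (trans (*-congˡ (twistedSum-cong weight P Q (^-cong N x≈y))) (sym (T≈twistedSum _)))

    T-at-primitive : ∀ {η} → HasOrder n η → evalₚ R (Tpoly R n a) η ≈ ιℕ R (N ℕ.* ∏ℕ (ℕ._∸ 1) P)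
    T-at-primitive {η} η-order = begin
      evalₚ R (Tpoly R n a) η                ≈⟨ T-cong (*-identityʳ η) ⟨
      evalₚ R (Tpoly R n a) (η ^ 1)          ≈⟨ T-at-root η-order 1 ⟩
      ιℕ R N * ∏ (dualFactor weight 1) P
        ≈⟨ *-congˡ (∏-cong (All.map (λ {j} → factor j) P-prime)) ⟩
      ιℕ R N * ∏ (ιℕ R ∘ (ℕ._∸ 1)) P         ≈⟨ *-congˡ (∏-ιℕ (ℕ._∸ 1) P) ⟩
      ιℕ R N * ιℕ R (∏ℕ (ℕ._∸ 1) P)          ≈⟨ ιℕ-homo-* N (∏ℕ (ℕ._∸ 1) P) ⟨
      ιℕ R (N ℕ.* ∏ℕ (ℕ._∸ 1) P)             ∎
      where
      factor : ∀ j → Prime (suc j) → dualFactor weight 1 j ≈ ιℕ R (j ℕ.∸ 1)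
      factor zero    p = contradiction p ¬prime[1]
      -- No prime divides 1, so only the weight p - 2 remains.
      factor (suc j) p = trans (reflexive (if-∣-no {x = ιℕ R (suc (suc j)) + weight (suc j)} {d = suc (suc j)} {k = 1}
                                                    (λ p∣1 → contradiction (∣1⇒≡1 p∣1) λ ())))
                               (xyx⁻¹≈y 1# (ιℕ R j))

    -- N and Q inherit oddness from n, so the twisted sum is taken at -1; its factors 1 + (p - 2) =
    -- p - 1 rebuild the product for φ(n).
    T-at-minus1-odd : (- 1#) ^ n ≈ - 1# → T-at-minus1 n a ≡ + φ n
    T-at-minus1-odd odd = charZero _ _ (begin
      ι R (T-at-minus1 n a)                          ≈⟨ ι-T-at-minus1 n a ⟩
      evalₚ R (Tpoly R n a) (- 1#)                   ≈⟨ T≈twistedSum (- 1#) ⟩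
      ιℕ R N * twistedSum weight P Q ((- 1#) ^ N)
        ≈⟨ *-congˡ (twistedSum-cong weight P Q ([-1]^-factor odd (divides Q n≡Q*N))) ⟩
      ιℕ R N * twistedSum weight P Q (- 1#)
        ≈⟨ *-congˡ (twistedSum-[-1] weight P-independent ([-1]^-factor odd (divides N n≡N*Q))) ⟩
      ιℕ R N * ∏ (λ j → 1# + weight j) P
        ≈⟨ *-congˡ (trans (∏-cong (All.universal (λ j → 1+[x-1]≈x (ιℕ R j)) P)) (∏-ιℕ id P)) ⟩
      ιℕ R N * ιℕ R (∏ℕ id P)                        ≈⟨ ιℕ-homo-* N (∏ℕ id P) ⟨
      ιℕ R (N ℕ.* ∏ℕ id P)                           ≡⟨ ≡.cong (ιℕ R) φ-formula ⟨
      ιℕ R (φ n)                                     ∎)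

    module Even {m} (n≡2*m : n ≡ 2 ℕ.* m) where

      2∣n : 2 ∣ n
      2∣n = divides m (≡.trans n≡2*m (ℕₚ.*-comm 2 m))

      ζᵐ≈-1 : ζ ^ m ≈ - 1#
      ζᵐ≈-1 = square-root-of-1
        (begin
          ζ ^ m * ζ ^ m        ≈⟨ *-congˡ (*-identityʳ _) ⟨
          (ζ ^ m) ^ 2          ≈⟨ ^-assoc ζ 2 m ⟨
          ζ ^ (2 ℕ.* m)        ≡⟨ ≡.cong (ζ ^_) n≡2*m ⟨
          ζ ^ n                ≈⟨ proj₁ order ⟩
          1#                   ∎)
        (λ ζᵐ≈1 → ℕₚ.<⇒≱ m<n (∣⇒≤ {{m≢0}} (proj₂ order m ζᵐ≈1)))
        where
        m≢0 : ℕ.NonZero m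
        m≢0 = ℕₚ.m*n≢0⇒n≢0 2 {{≡.subst ℕ.NonZero n≡2*m n≢0}}
        m<n : m ℕ.< n
        m<n = ≡.subst (m ℕ.<_) (≡.sym n≡2*m)
                (ℕₚ.m<m+n m (ℕ.>-nonZero⁻¹ (m ℕ.+ 0) {{≡.subst ℕ.NonZero (≡.sym (ℕₚ.+-identityʳ m)) m≢0}}))

      T-at-odd-power : ∀ {η} → HasOrder n η → ∀ k → 2 ∤ k → evalₚ R (Tpoly R n a) (η ^ k) ≈ 0#
      T-at-odd-power η-order k 2∤k = trans (T-at-root η-order k)
        (trans (*-congˡ (∏-zero 1∈P factor≈0)) (zeroʳ _))
        where
        -- The entry 1 stands for the prime 2, whose weight 2 - 2 is zero.
        1∈P : 1 ∈ P
        1∈P = P-complete prime[2] 2∣n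
        factor≈0 : dualFactor weight k 1 ≈ 0#
        factor≈0 = trans (reflexive (if-∣-no 2∤k)) (xyx⁻¹≈y 1# 0#)

      T-at-minus1-≈ : ι R (T-at-minus1 n a) ≈ evalₚ R (Tpoly R n a) (ζ ^ m)
      T-at-minus1-≈ = trans (ι-T-at-minus1 n a) (T-cong (sym ζᵐ≈-1))

      T-at-minus1-2-mod-4 : 2 ∤ m → T-at-minus1 n a ≡ + 0
      T-at-minus1-2-mod-4 2∤m = charZero _ _ (trans T-at-minus1-≈ (T-at-odd-power order m 2∤m))

      -- Since m is even, every prime of n = 2m divides m. Each factor is then p + (p - 2) = 2 (p -
      -- 1), which yields φ(n) and one 2 per prime.
      T-at-minus1-0-mod-4 : 2 ∣ m → T-at-minus1 n a ≡ + (φ n ℕ.* 2 ℕ.^ ω n)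
      T-at-minus1-0-mod-4 2∣m = charZero _ _ (begin
        ι R (T-at-minus1 n a)                      ≈⟨ T-at-minus1-≈ ⟩
        evalₚ R (Tpoly R n a) (ζ ^ m)              ≈⟨ T-at-root order m ⟩
        ιℕ R N * ∏ (dualFactor weight m) P
          ≈⟨ *-congˡ (∏-cong (All.zipWith factor (P-prime , P∣n))) ⟩
        ιℕ R N * ∏ (ιℕ R ∘ (2 ℕ.*_)) P             ≈⟨ *-congˡ (∏-ιℕ (2 ℕ.*_) P) ⟩
        ιℕ R N * ιℕ R (∏ℕ (2 ℕ.*_) P)              ≈⟨ ιℕ-homo-* N (∏ℕ (2 ℕ.*_) P) ⟨
        ιℕ R (N ℕ.* ∏ℕ (2 ℕ.*_) P)                 ≡⟨ ≡.cong (ιℕ R) value ⟩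
        ιℕ R (φ n ℕ.* 2 ℕ.^ ω n)                   ∎)
        where
        value : N ℕ.* ∏ℕ (2 ℕ.*_) P ≡ φ n ℕ.* 2 ℕ.^ ω n
        value = ≡.trans (≡.cong (N ℕ.*_) (∏ℕ-double P))
          (≡.trans (≡.sym (ℕₚ.*-assoc N (∏ℕ id P) (2 ℕ.^ ω n))) (≡.cong (ℕ._* 2 ℕ.^ ω n) (≡.sym φ-formula)))
        p∣m : ∀ {p} → Prime p → p ∣ n → p ∣ m
        p∣m {p} pp p∣n with euclidsLemma 2 m pp (≡.subst (p ∣_) n≡2*m p∣n)
        ... | inj₁ p∣2 = ∣-trans p∣2 2∣m
        ... | inj₂ p∣m = p∣m
        factor : ∀ {j} → Prime (suc j) × suc j ∣ n → dualFactor weight m j ≈ ιℕ R (2 ℕ.* j)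
        factor {j} (pp , p∣n) = begin
          dualFactor weight m j                    ≡⟨ if-∣-yes (p∣m pp p∣n) ⟩
          (1# + ιℕ R j) + (ιℕ R j - 1#)
            ≈⟨ solve 3 (λ o x y → (o :+ x) :+ y := x :+ (o :+ y)) refl 1# _ _ ⟩
          ιℕ R j + (1# + (ιℕ R j - 1#))            ≈⟨ +-congˡ (1+[x-1]≈x _) ⟩
          ιℕ R j + ιℕ R j                          ≡⟨ ≡.cong (λ k → ιℕ R j + ιℕ R k) (ℕₚ.+-identityʳ j) ⟨
          ιℕ R j + ιℕ R (j ℕ.+ 0)                  ≈⟨ ιℕ-homo-+ j (j ℕ.+ 0) ⟨
          ιℕ R (2 ℕ.* j)                           ∎

      -- The roots of Φ_n are distinct powers ζ^j with j coprime to the even n; such j are odd, so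
      -- T_n vanishes at each of them.
      cyclotomic-∣ₚ-T : _∣ₚ_ R (cyclotomic R n ζ) (Tpoly R n a)
      cyclotomic-∣ₚ-T = Polynomials.distinct-roots⇒∣ₚ R domain (ζ ^_) (Tpoly R n a)
        (AllPairsₚ.filter⁺ (λ j → coprime? j n)
          (AllPairsₚ.map⁺ (AllPairsₚ.applyUpTo⁺₁ id n (λ i<j j<n → powers-distinct order i<j j<n))))
        (All.map (λ {j} cop → T-at-odd-power order j (λ 2∣j → contradiction (cop (2∣j , 2∣n)) λ ()))
          (Allₚ.all-filter (λ j → coprime? j n) (oneTo n)))

-- The four evaluations and the divisibility combined

open import Data.Nat using (_≤_; _*_; _+_; _^_)

theorem12 : ∀ {c ℓ} (R : CommutativeRing c ℓ) → IsIntegralDomain R → CharZero R →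
    ∀ (n : ℕ) → 1 ≤ n → ∀ (ζ : CommutativeRing.Carrier R) → IsPrimitiveRoot R n ζ →
    ∀ (a : ℕ → ℤ) → IsRamanujanTable R n ζ a →
    ((∃[ k ] n ≡ 2 * k + 1) → T-at-minus1 n a ≡ + φ n)
    × ((∃[ k ] n ≡ 4 * k + 2) → T-at-minus1 n a ≡ + 0)
    × ((∃[ k ] (1 ≤ k × n ≡ 4 * k)) → T-at-minus1 n a ≡ + (φ n * 2 ^ ω n))
    × (∀ (η : CommutativeRing.Carrier R) → IsPrimitiveRoot R n η →
    Σ ℤ (λ m → (m ℚ./ 1 ≡ nProd12p n)
    × CommutativeRing._≈_ R (evalₚ R (Tpoly R n a) η) (ι R m)))
    × ((∃[ k ] (1 ≤ k × n ≡ 2 * k)) → _∣ₚ_ R (cyclotomic R n ζ) (Tpoly R n a))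
theorem12 R domain charZero n 1≤n ζ ζ-primitive a table
  with ∏suc∣ (PrimeDivisors.P-independent n) (PrimeDivisors.P∣n n)
-- The quotient of n by its radical is N; it is nonzero because n is.
... | divides zero n≡0 = contradiction n≡0 (ℕₚ.m<n⇒n≢0 1≤n)
... | divides (suc N-1) n≡N*Q =
    (λ (k , n≡2k+1) → T-at-minus1-odd ([-1]^odd k n≡2k+1))
  , (λ (k , n≡4k+2) → Even.T-at-minus1-2-mod-4 {2 * k + 1} (≡.trans n≡4k+2 (4k+2≡2[2k+1] k)) (2∤2k+1 k))
  , (λ (k , _ , n≡4k) → Even.T-at-minus1-0-mod-4 {2 * k} (≡.trans n≡4k (ℕₚ.*-assoc 2 2 k)) (m∣m*n k))
  , (λ η η-primitive → + (N * ∏ℕ (ℕ._∸ 1) P)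
      , ≡.trans (≡.sym (nProd-formula P (All.map prime⇒1≤pred P-prime) N))
          -- The fold in `nProd-formula` starts from N Q, the one in `nProd12p` from n.
          (≡.cong (λ m → foldr (λ j q → (ℚ.1ℚ ℚ.- (+ 2 ℚ./ suc j)) ℚ.* q) (+ m ℚ./ 1) P) (≡.sym n≡N*Q))
      , T-at-primitive (primitive⇒order 1≤n η-primitive))
  , (λ (k , _ , n≡2k) → Even.cyclotomic-∣ₚ-T {k} n≡2k)
  where
  instance
    n≢0 : ℕ.NonZero n
    n≢0 = ℕ.>-nonZero 1≤n
  open PrimeDivisors n
  open Roots R domain charZero using (primitive⇒order; [-1]^odd)
  open RamanujanSums R domain charZero n N-1 n≡N*Q
  open Table (primitive⇒order 1≤n ζ-primitive) a table
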